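{- Let $S,T$ be as in the context. Every $\Sigma_1$ provability predicate $\mathrm{Pr}_T(x)$ of $T$ satisfying $\mathbf{E}^{\mathrm{U}}$ and $\mathbf{CB}_{\exists}$ also satisfies $\mathbf{\Sigma_1C}$.
   Context: $\mathcal{L}_A=\{0,\mathsf{s},+,\times,\leq\}$ is the language of first-order arithmetic, and "formula" means $\mathcal{L}_A$-formula; $\ulcorner\varphi\urcorner$ is the numeral of the Gödel number of $\varphi$. $\Sigma_1$ formulas are those of the form $\exists\vec{x}\,\delta$ with $\delta$ a $\Delta_0$ formula. $S$ and $T$ are consistent c.e. extensions of Peano Arithmetic $\mathsf{PA}$ in the language $\mathcal{L}_A$ such that $T$ is stronger than $S$ (every theorem of $S$ is a theorem of $T$; $S=T$ is allowed). A formula $\mathrm{Pr}_T(x)$ is a provability predicate of $T$ if for every formula $\varphi$: $T\vdash\varphi$ if and only if $S\vdash\mathrm{Pr}_T(\ulcorner\varphi\urcorner)$. A $\Sigma_1$ provability predicate is one that is a $\Sigma_1$ formula. $\ulcorner\varphi(\vec{\dot{x}})\urcorner$ is a term with free variables $\vec{x}$ for the primitive recursive function that computes from $\vec{n}$ the Gödel number of $\varphi(\overline{\vec{n}})$, the result of substituting the numerals of $\vec{n}$ for $\vec{x}$ in $\varphi(\vec{x})$. Conditions on $\mathrm{Pr}_T(x)$: - $\mathbf{E}^{\mathrm{U}}$: for all formulas $\varphi(\vec{x}),\psi(\vec{x})$, if $T\vdash\forall\vec{x}\,(\varphi(\vec{x})\leftrightarrow\psi(\vec{x}))$, then $S\vdash\forall\vec{x}\,(\mathrm{Pr}_T(\ulcorner\varphi(\vec{\dot{x}})\urcorner)\leftrightarrow\mathrm{Pr}_T(\ulcorner\psi(\vec{\dot{x}})\urcorner))$.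 - $\mathbf{CB}_{\exists}$: $S\vdash\exists\vec{x}\,\mathrm{Pr}_T(\ulcorner\varphi(\vec{\dot{x}})\urcorner)\to\mathrm{Pr}_T(\ulcorner\exists\vec{x}\,\varphi(\vec{x})\urcorner)$ for every formula $\varphi(\vec{x})$. - $\mathbf{\Sigma_1C}$: $S\vdash\varphi\to\mathrm{Pr}_T(\ulcorner\varphi\urcorner)$ for every $\Sigma_1$ sentence $\varphi$. -}

module Defs where

open import Data.Fin using (Fin; zero; suc; toℕ; splitAt; _↑ˡ_)
open import Data.Fin.Properties using (toℕ-injective; toℕ-↑ˡ)
open import Data.List using (List; []; _∷_; map)
open import Data.List.Membership.Propositional using (_∈_)
open import Data.Nat as ℕ using (ℕ; zero; suc)
import Data.Nat.Properties as ℕₚ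
open import Data.Product using (Σ; ∃; _×_; _,_)
open import Data.Sum using (inj₁; inj₂; [_,_]′)
open import Data.Vec as Vec using (Vec; []; _∷_)
open import Function using (_∘_)
open import Function.Bundles using (_⇔_)
open import Relation.Binary.Definitions using (tri<; tri≈; tri>)
open import Relation.Binary.PropositionalEquality using (_≡_; refl; sym; trans; cong; cong₂)
open import Relation.Nullary using (¬_; contradiction)

private
  variable
    m n : ℕ

-- Variables are well-scoped de Bruijn indices: a formula whose free
-- variables are among x₀, …, xₙ₋₁ is an element of Formula n.

infixl 8 _⊕_
infixl 9 _⊗_
infix  7 _≐_ _≤̇_
infix  6 ∀̇_ ∃̇_ ¬̇_
infixr 5 _∧_
infixr 4 _∨_
infixr 3 _⇒_
infix  2 _⇔̇_

data Term (n : ℕ) : Set where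
  var : Fin n → Term n
  O   : Term n
  s   : Term n → Term n
  _⊕_ : Term n → Term n → Term n
  _⊗_ : Term n → Term n → Term n

data Formula (n : ℕ) : Set where
  ⊥̇   : Formula n
  _≐_ : Term n → Term n → Formula n
  _≤̇_ : Term n → Term n → Formula n
  _⇒_ : Formula n → Formula n → Formula n
  _∧_ : Formula n → Formula n → Formula n
  _∨_ : Formula n → Formula n → Formula n
  ∀̇_  : Formula (suc n) → Formula n
  ∃̇_  : Formula (suc n) → Formula n

Sentence : Set
Sentence = Formula 0

¬̇_ : Formula n → Formula n
¬̇ φ = φ ⇒ ⊥̇

_⇔̇_ : Formula n → Formula n → Formula n
φ ⇔̇ ψ = (φ ⇒ ψ) ∧ (ψ ⇒ φ)

∀* : Formula n → Sentence
∀* {zero}  φ = φ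
∀* {suc n} φ = ∀* (∀̇ φ)

∃* : Formula n → Sentence
∃* {zero}  φ = φ
∃* {suc n} φ = ∃* (∃̇ φ)

numeral : ℕ → Term n
numeral zero    = O
numeral (suc k) = s (numeral k)

Ren : ℕ → ℕ → Set
Ren m n = Fin m → Fin n

Sub : ℕ → ℕ → Set
Sub m n = Fin m → Term n

renₜ : Ren m n → Term m → Term n
renₜ ρ (var i) = var (ρ i)
renₜ ρ O       = O
renₜ ρ (s t)   = s (renₜ ρ t)
renₜ ρ (t ⊕ u) = renₜ ρ t ⊕ renₜ ρ u
renₜ ρ (t ⊗ u) = renₜ ρ t ⊗ renₜ ρ u

liftᵣ : Ren m n → Ren (suc m) (suc n)
liftᵣ ρ zero    = zero
liftᵣ ρ (suc i) = suc (ρ i)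

ren : Ren m n → Formula m → Formula n
ren ρ ⊥̇       = ⊥̇
ren ρ (t ≐ u) = renₜ ρ t ≐ renₜ ρ u
ren ρ (t ≤̇ u) = renₜ ρ t ≤̇ renₜ ρ u
ren ρ (φ ⇒ ψ) = ren ρ φ ⇒ ren ρ ψ
ren ρ (φ ∧ ψ) = ren ρ φ ∧ ren ρ ψ
ren ρ (φ ∨ ψ) = ren ρ φ ∨ ren ρ ψ
ren ρ (∀̇ φ)   = ∀̇ ren (liftᵣ ρ) φ
ren ρ (∃̇ φ)   = ∃̇ ren (liftᵣ ρ) φ

wkₜ : Term n → Term (suc n)
wkₜ = renₜ suc

wk : Formula n → Formula (suc n)
wk = ren suc

embed : Sentence → Formula n
embed = ren λ ()

subₜ : Sub m n → Term m → Term n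
subₜ σ (var i) = σ i
subₜ σ O       = O
subₜ σ (s t)   = s (subₜ σ t)
subₜ σ (t ⊕ u) = subₜ σ t ⊕ subₜ σ u
subₜ σ (t ⊗ u) = subₜ σ t ⊗ subₜ σ u

lift : Sub m n → Sub (suc m) (suc n)
lift σ zero    = var zero
lift σ (suc i) = wkₜ (σ i)

sub : Sub m n → Formula m → Formula n
sub σ ⊥̇       = ⊥̇
sub σ (t ≐ u) = subₜ σ t ≐ subₜ σ u
sub σ (t ≤̇ u) = subₜ σ t ≤̇ subₜ σ u
sub σ (φ ⇒ ψ) = sub σ φ ⇒ sub σ ψ
sub σ (φ ∧ ψ) = sub σ φ ∧ sub σ ψ
sub σ (φ ∨ ψ) = sub σ φ ∨ sub σ ψ
sub σ (∀̇ φ)   = ∀̇ sub (lift σ) φ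
sub σ (∃̇ φ)   = ∃̇ sub (lift σ) φ

single : Term n → Sub (suc n) n
single t zero    = t
single t (suc i) = var i

infix 10 _[_]

_[_] : Formula (suc n) → Term n → Formula n
φ [ t ] = sub (single t) φ

-- P ⟨ t ⟩ is P(t) for a formula P(x) with x as its only free variable.
infix 10 _⟨_⟩

_⟨_⟩ : Formula 1 → Term n → Formula n
P ⟨ t ⟩ = sub (λ _ → t) P

-- φ(x, y⃗) ↦ φ(s x, y⃗)
step : Formula (suc n) → Formula (suc n)
step {n} = sub σ
  where
  σ : Sub (suc n) (suc n)
  σ zero    = s (var zero)
  σ (suc i) = var (suc i)

data Δ₀ {n : ℕ} : Formula n → Set where
  bot : Δ₀ ⊥̇
  eq  : ∀ t u → Δ₀ (t ≐ u)
  le  : ∀ t u → Δ₀ (t ≤̇ u)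
  imp : ∀ {φ ψ} → Δ₀ φ → Δ₀ ψ → Δ₀ (φ ⇒ ψ)
  and : ∀ {φ ψ} → Δ₀ φ → Δ₀ ψ → Δ₀ (φ ∧ ψ)
  or  : ∀ {φ ψ} → Δ₀ φ → Δ₀ ψ → Δ₀ (φ ∨ ψ)
  all : ∀ t {φ} → Δ₀ φ → Δ₀ (∀̇ (var zero ≤̇ wkₜ t ⇒ φ))
  ex  : ∀ t {φ} → Δ₀ φ → Δ₀ (∃̇ (var zero ≤̇ wkₜ t ∧ φ))

data Σ₁ {n : ℕ} : Formula n → Set where
  matrix : ∀ {φ} → Δ₀ φ → Σ₁ φ
  exists : ∀ {φ} → Σ₁ φ → Σ₁ (∃̇ φ)

-- A theory is its set of non-logical axioms; provability is classical
-- first-order logic with equality.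

Theory : Set₁
Theory = Sentence → Set

infix 1 _∣_⊩_ _⊢_

data _∣_⊩_ (T : Theory) {n : ℕ} (Γ : List (Formula n)) : Formula n → Set where
  axiom : ∀ {σ} → T σ → T ∣ Γ ⊩ embed σ
  hyp   : ∀ {φ} → φ ∈ Γ → T ∣ Γ ⊩ φ
  raa   : ∀ {φ} → T ∣ ¬̇ φ ∷ Γ ⊩ ⊥̇ → T ∣ Γ ⊩ φ
  ⇒I    : ∀ {φ ψ} → T ∣ φ ∷ Γ ⊩ ψ → T ∣ Γ ⊩ φ ⇒ ψ
  ⇒E    : ∀ {φ ψ} → T ∣ Γ ⊩ φ ⇒ ψ → T ∣ Γ ⊩ φ → T ∣ Γ ⊩ ψ
  ∧I    : ∀ {φ ψ} → T ∣ Γ ⊩ φ → T ∣ Γ ⊩ ψ → T ∣ Γ ⊩ φ ∧ ψ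
  ∧E₁   : ∀ {φ ψ} → T ∣ Γ ⊩ φ ∧ ψ → T ∣ Γ ⊩ φ
  ∧E₂   : ∀ {φ ψ} → T ∣ Γ ⊩ φ ∧ ψ → T ∣ Γ ⊩ ψ
  ∨I₁   : ∀ {φ ψ} → T ∣ Γ ⊩ φ → T ∣ Γ ⊩ φ ∨ ψ
  ∨I₂   : ∀ {φ ψ} → T ∣ Γ ⊩ ψ → T ∣ Γ ⊩ φ ∨ ψ
  ∨E    : ∀ {φ ψ χ} → T ∣ Γ ⊩ φ ∨ ψ → T ∣ φ ∷ Γ ⊩ χ → T ∣ ψ ∷ Γ ⊩ χ → T ∣ Γ ⊩ χ
  ∀I    : ∀ {φ} → T ∣ map wk Γ ⊩ φ → T ∣ Γ ⊩ ∀̇ φ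
  ∀E    : ∀ {φ} t → T ∣ Γ ⊩ ∀̇ φ → T ∣ Γ ⊩ φ [ t ]
  ∃I    : ∀ {φ} t → T ∣ Γ ⊩ φ [ t ] → T ∣ Γ ⊩ ∃̇ φ
  ∃E    : ∀ {φ χ} → T ∣ Γ ⊩ ∃̇ φ → T ∣ φ ∷ map wk Γ ⊩ wk χ → T ∣ Γ ⊩ χ
  ≐I    : ∀ t → T ∣ Γ ⊩ t ≐ t
  ≐E    : ∀ φ {t u} → T ∣ Γ ⊩ t ≐ u → T ∣ Γ ⊩ φ [ t ] → T ∣ Γ ⊩ φ [ u ]

_⊢_ : Theory → Formula n → Set
T ⊢ φ = T ∣ [] ⊩ φ

Consistent : Theory → Set
Consistent T = ¬ (T ⊢ ⊥̇ {0})

-- Every theorem of the second theory is a theorem of the first.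
_Extends_ : Theory → Theory → Set
T Extends U = ∀ {n} (φ : Formula n) → U ⊢ φ → T ⊢ φ

private
  x₀ : Term (suc n)
  x₀ = var zero

  x₁ : Term (suc (suc n))
  x₁ = var (suc zero)

  x₂ : Term (suc (suc (suc n)))
  x₂ = var (suc (suc zero))

data PA : Theory where
  S≢0   : PA (∀̇ ¬̇ (s x₀ ≐ O))
  S-inj : PA (∀̇ ∀̇ (s x₁ ≐ s x₀ ⇒ x₁ ≐ x₀))
  +-O   : PA (∀̇ (x₀ ⊕ O ≐ x₀))
  +-S   : PA (∀̇ ∀̇ (x₁ ⊕ s x₀ ≐ s (x₁ ⊕ x₀)))
  *-O   : PA (∀̇ (x₀ ⊗ O ≐ O))
  *-S   : PA (∀̇ ∀̇ (x₁ ⊗ s x₀ ≐ x₁ ⊗ x₀ ⊕ x₁))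
  ≤-def : PA (∀̇ ∀̇ (x₁ ≤̇ x₀ ⇔̇ ∃̇ (x₂ ⊕ x₀ ≐ x₁)))
  ind   : ∀ {n} (φ : Formula (suc n)) →
          PA (∀* (φ [ O ] ∧ (∀̇ (φ ⇒ step φ)) ⇒ ∀̇ φ))

-- Gödel numbers.  The pairing function is a polynomial, and a term
-- s(…s(t)…) with k outer successors (t not a successor) is coded by k
-- and a code of t.  Hence the number of φ(n₀, …) is a polynomial in
-- n₀, …, so the function ⌜φ(ẋ₀, …)⌝ below is given by an L_A-term.

pair : ℕ → ℕ → ℕ
pair a b = (a ℕ.+ b) ℕ.* (a ℕ.+ b) ℕ.+ a

successors : Term n → ℕ
successors (s t) = suc (successors t)
successors _     = 0

headTag : Term n → ℕ
headTag O       = 0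
headTag (var _) = 1
headTag (_ ⊕ _) = 2
headTag (_ ⊗ _) = 3
headTag (s t)   = headTag t

mutual
  gnₜ : Term n → ℕ
  gnₜ t = pair (successors t) (pair (headTag t) (headArgs t))

  headArgs : Term n → ℕ
  headArgs O       = 0
  headArgs (var i) = toℕ i
  headArgs (t ⊕ u) = pair (gnₜ t) (gnₜ u)
  headArgs (t ⊗ u) = pair (gnₜ t) (gnₜ u)
  headArgs (s t)   = headArgs t

tag : Formula n → ℕ
tag ⊥̇       = 0
tag (_ ≐ _) = 1
tag (_ ≤̇ _) = 2
tag (_ ⇒ _) = 3
tag (_ ∧ _) = 4
tag (_ ∨ _) = 5
tag (∀̇ _)   = 6
tag (∃̇ _)   = 7

mutual
  gn : Formula n → ℕ
  gn φ = pair (tag φ) (args φ)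

  args : Formula n → ℕ
  args ⊥̇       = 0
  args (t ≐ u) = pair (gnₜ t) (gnₜ u)
  args (t ≤̇ u) = pair (gnₜ t) (gnₜ u)
  args (φ ⇒ ψ) = pair (gn φ) (gn ψ)
  args (φ ∧ ψ) = pair (gn φ) (gn ψ)
  args (φ ∨ ψ) = pair (gn φ) (gn ψ)
  args (∀̇ φ)   = gn φ
  args (∃̇ φ)   = gn φ

⌜_⌝ : Formula m → Term n
⌜ φ ⌝ = numeral (gn φ)

-- The term ⌜φ(ẋ₀, …, ẋₙ₋₁)⌝.  In the auxiliary functions the first k
-- variables are bound and stay variables; the other n are dotted.

pairᵈ : Term n → Term n → Term n
pairᵈ a b = (a ⊕ b) ⊗ (a ⊕ b) ⊕ a

successorsᵈ : ∀ k → Term (k ℕ.+ n) → Term n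
successorsᵈ k (s t)   = s (successorsᵈ k t)
successorsᵈ k (var i) = [ (λ _ → O) , var ]′ (splitAt k i)
successorsᵈ k _       = O

headTagᵈ : ∀ k → Term (k ℕ.+ n) → Term n
headTagᵈ k (var i) = [ (λ _ → numeral 1) , (λ _ → numeral 0) ]′ (splitAt k i)
headTagᵈ k (s t)   = headTagᵈ k t
headTagᵈ k t       = numeral (headTag t)

mutual
  gnₜᵈ : ∀ k → Term (k ℕ.+ n) → Term n
  gnₜᵈ k t = pairᵈ (successorsᵈ k t) (pairᵈ (headTagᵈ k t) (headArgsᵈ k t))

  headArgsᵈ : ∀ k → Term (k ℕ.+ n) → Term n
  headArgsᵈ k O       = O
  headArgsᵈ k (var i) = [ (λ b → numeral (toℕ b)) , (λ _ → O) ]′ (splitAt k i)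
  headArgsᵈ k (t ⊕ u) = pairᵈ (gnₜᵈ k t) (gnₜᵈ k u)
  headArgsᵈ k (t ⊗ u) = pairᵈ (gnₜᵈ k t) (gnₜᵈ k u)
  headArgsᵈ k (s t)   = headArgsᵈ k t

mutual
  gnᵈ : ∀ k → Formula (k ℕ.+ n) → Term n
  gnᵈ k φ = pairᵈ (numeral (tag φ)) (argsᵈ k φ)

  argsᵈ : ∀ k → Formula (k ℕ.+ n) → Term n
  argsᵈ k ⊥̇       = O
  argsᵈ k (t ≐ u) = pairᵈ (gnₜᵈ k t) (gnₜᵈ k u)
  argsᵈ k (t ≤̇ u) = pairᵈ (gnₜᵈ k t) (gnₜᵈ k u)
  argsᵈ k (φ ⇒ ψ) = pairᵈ (gnᵈ k φ) (gnᵈ k ψ)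
  argsᵈ k (φ ∧ ψ) = pairᵈ (gnᵈ k φ) (gnᵈ k ψ)
  argsᵈ k (φ ∨ ψ) = pairᵈ (gnᵈ k φ) (gnᵈ k ψ)
  argsᵈ k (∀̇ φ)   = gnᵈ (suc k) φ
  argsᵈ k (∃̇ φ)   = gnᵈ (suc k) φ

⌜_⌝ᵈ : Formula n → Term n
⌜ φ ⌝ᵈ = gnᵈ 0 φ

private
  pair-mono : ∀ a b c d → a ℕ.+ b ℕ.< c ℕ.+ d → pair a b ℕ.< pair c d
  pair-mono a b c d p = begin-strict
    q ℕ.* q ℕ.+ a               <⟨ ℕ.s≤s (ℕₚ.+-monoʳ-≤ (q ℕ.* q) (ℕₚ.m≤m+n a b)) ⟩
    suc (q ℕ.* q ℕ.+ q)         ≤⟨ ℕ.s≤s (ℕₚ.m≤n+m _ q) ⟩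
    suc (q ℕ.+ (q ℕ.* q ℕ.+ q)) ≡⟨ cong (λ z → suc (q ℕ.+ z)) (trans (ℕₚ.+-comm (q ℕ.* q) q) (sym (ℕₚ.*-suc q q))) ⟩
    suc q ℕ.* suc q             ≤⟨ ℕₚ.*-mono-≤ p p ⟩
    (c ℕ.+ d) ℕ.* (c ℕ.+ d)     ≤⟨ ℕₚ.m≤m+n _ c ⟩
    pair c d                    ∎
    where
    open ℕₚ.≤-Reasoning
    q = a ℕ.+ b

pair-injective : ∀ a b c d → pair a b ≡ pair c d → a ≡ c × b ≡ d
pair-injective a b c d e with ℕₚ.<-cmp (a ℕ.+ b) (c ℕ.+ d)
... | tri< p _ _ = contradiction e (ℕₚ.<⇒≢ (pair-mono a b c d p))
... | tri> _ _ p = contradiction (sym e) (ℕₚ.<⇒≢ (pair-mono c d a b p))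
... | tri≈ _ q _ = a≡c , ℕₚ.+-cancelˡ-≡ a b d (trans q (cong (ℕ._+ d) (sym a≡c)))
  where
  a≡c : a ≡ c
  a≡c = ℕₚ.+-cancelˡ-≡ ((a ℕ.+ b) ℕ.* (a ℕ.+ b)) a c
          (trans e (cong (λ s → s ℕ.* s ℕ.+ c) (sym q)))

private
  cong-pair : {A B C : Set} {f : A → ℕ} {g : B → ℕ} (h : A → B → C) →
              ∀ a b a′ b′ → (f a ≡ f a′ → a ≡ a′) → (g b ≡ g b′ → b ≡ b′) →
              pair (f a) (g b) ≡ pair (f a′) (g b′) → h a b ≡ h a′ b′
  cong-pair h a b a′ b′ i j e =
    let (p , q) = pair-injective _ _ _ _ e in cong₂ h (i p) (j q)

  mutual
    term-injective : (t u : Term n) → successors t ≡ successors u →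
                     headTag t ≡ headTag u → headArgs t ≡ headArgs u → t ≡ u
    term-injective O       O         _ _ _ = refl
    term-injective (var i) (var j)   _ _ e = cong var (toℕ-injective e)
    term-injective (t ⊕ u) (t′ ⊕ u′) _ refl e =
      cong-pair _⊕_ t u t′ u′ (gnₜ-injective t t′) (gnₜ-injective u u′) e
    term-injective (t ⊗ u) (t′ ⊗ u′) _ refl e =
      cong-pair _⊗_ t u t′ u′ (gnₜ-injective t t′) (gnₜ-injective u u′) e
    term-injective (s t)   (s u)     p q e =
      cong s (term-injective t u (ℕₚ.suc-injective p) q e)

    gnₜ-injective : (t u : Term n) → gnₜ t ≡ gnₜ u → t ≡ u
    gnₜ-injective t u e =
      let (p , e′) = pair-injective (successors t) _ (successors u) _ e
          (q , r)  = pair-injective (headTag t) _ (headTag u) _ e′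
      in term-injective t u p q r

mutual
  gn-injective : (φ ψ : Formula n) → gn φ ≡ gn ψ → φ ≡ ψ
  gn-injective φ ψ e =
    let (p , q) = pair-injective (tag φ) _ (tag ψ) _ e in formula-injective φ ψ p q

  private
    formula-injective : (φ ψ : Formula n) → tag φ ≡ tag ψ → args φ ≡ args ψ → φ ≡ ψ
    formula-injective ⊥̇ ⊥̇ refl _ = refl
    formula-injective (t ≐ u) (t′ ≐ u′) refl e =
      cong-pair _≐_ t u t′ u′ (gnₜ-injective t t′) (gnₜ-injective u u′) e
    formula-injective (t ≤̇ u) (t′ ≤̇ u′) refl e =
      cong-pair _≤̇_ t u t′ u′ (gnₜ-injective t t′) (gnₜ-injective u u′) e
    formula-injective (φ ⇒ ψ) (φ′ ⇒ ψ′) refl e =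
      cong-pair _⇒_ φ ψ φ′ ψ′ (gn-injective φ φ′) (gn-injective ψ ψ′) e
    formula-injective (φ ∧ ψ) (φ′ ∧ ψ′) refl e =
      cong-pair _∧_ φ ψ φ′ ψ′ (gn-injective φ φ′) (gn-injective ψ ψ′) e
    formula-injective (φ ∨ ψ) (φ′ ∨ ψ′) refl e =
      cong-pair _∨_ φ ψ φ′ ψ′ (gn-injective φ φ′) (gn-injective ψ ψ′) e
    formula-injective (∀̇ φ) (∀̇ ψ) refl e = cong ∀̇_ (gn-injective φ ψ e)
    formula-injective (∃̇ φ) (∃̇ ψ) refl e = cong ∃̇_ (gn-injective φ ψ e)

-- The value of ⌜φ(ẋ₀, …)⌝ at (k₀, …) is the Gödel number of φ(k̅₀, …).

⟦_⟧ : Term n → (Fin n → ℕ) → ℕ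
⟦ var i ⟧ ρ = ρ i
⟦ O ⟧     ρ = 0
⟦ s t ⟧   ρ = suc (⟦ t ⟧ ρ)
⟦ t ⊕ u ⟧ ρ = ⟦ t ⟧ ρ ℕ.+ ⟦ u ⟧ ρ
⟦ t ⊗ u ⟧ ρ = ⟦ t ⟧ ρ ℕ.* ⟦ u ⟧ ρ

private
  module _ {n : ℕ} (ρ : Fin n → ℕ) where

    σ : ∀ k → Sub (k ℕ.+ n) (k ℕ.+ m)
    σ zero    = numeral ∘ ρ
    σ (suc k) = lift (σ k)

    value-numeral : ∀ j → ⟦ numeral {n} j ⟧ ρ ≡ j
    value-numeral zero    = refl
    value-numeral (suc j) = cong suc (value-numeral j)

    wkₜ-numeral : ∀ j → wkₜ {m} (numeral j) ≡ numeral j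
    wkₜ-numeral zero    = refl
    wkₜ-numeral (suc j) = cong s (wkₜ-numeral j)

    σ-var : ∀ k i → σ {m} k i ≡ [ (λ b → var (b ↑ˡ m)) , (λ j → numeral (ρ j)) ]′ (splitAt k i)
    σ-var zero    i       = refl
    σ-var (suc k) zero    = refl
    σ-var {m} (suc k) (suc i) rewrite σ-var {m} k i with splitAt k i
    ... | inj₁ b = refl
    ... | inj₂ j = wkₜ-numeral (ρ j)

    successors-numeral : ∀ j → successors (numeral {m} j) ≡ j
    successors-numeral zero    = refl
    successors-numeral (suc j) = cong suc (successors-numeral j)

    headTag-numeral : ∀ j → headTag (numeral {m} j) ≡ 0
    headTag-numeral zero    = refl
    headTag-numeral (suc j) = headTag-numeral j

    headArgs-numeral : ∀ j → headArgs (numeral {m} j) ≡ 0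
    headArgs-numeral zero    = refl
    headArgs-numeral (suc j) = headArgs-numeral j

    successors-value : ∀ k t → ⟦ successorsᵈ k t ⟧ ρ ≡ successors (subₜ (σ {m} k) t)
    successors-value {m} k (var i) rewrite σ-var {m} k i with splitAt k i
    ... | inj₁ b = refl
    ... | inj₂ j = sym (successors-numeral (ρ j))
    successors-value k O       = refl
    successors-value k (s t)   = cong suc (successors-value k t)
    successors-value k (t ⊕ u) = refl
    successors-value k (t ⊗ u) = refl

    headTag-value : ∀ k t → ⟦ headTagᵈ k t ⟧ ρ ≡ headTag (subₜ (σ {m} k) t)
    headTag-value {m} k (var i) rewrite σ-var {m} k i with splitAt k i
    ... | inj₁ b = refl
    ... | inj₂ j = sym (headTag-numeral (ρ j))
    headTag-value k O       = refl
    headTag-value k (s t)   = headTag-value k t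
    headTag-value k (t ⊕ u) = refl
    headTag-value k (t ⊗ u) = refl

    mutual
      gnₜ-value : ∀ k t → ⟦ gnₜᵈ k t ⟧ ρ ≡ gnₜ (subₜ (σ {m} k) t)
      gnₜ-value k t = cong₂ pair (successors-value k t)
                        (cong₂ pair (headTag-value k t) (headArgs-value k t))

      headArgs-value : ∀ k t → ⟦ headArgsᵈ k t ⟧ ρ ≡ headArgs (subₜ (σ {m} k) t)
      headArgs-value {m} k (var i) rewrite σ-var {m} k i with splitAt k i
      ... | inj₁ b = trans (value-numeral (toℕ b)) (sym (toℕ-↑ˡ b m))
      ... | inj₂ j = sym (headArgs-numeral (ρ j))
      headArgs-value k O       = refl
      headArgs-value k (s t)   = headArgs-value k t
      headArgs-value k (t ⊕ u) = cong₂ pair (gnₜ-value k t) (gnₜ-value k u)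
      headArgs-value k (t ⊗ u) = cong₂ pair (gnₜ-value k t) (gnₜ-value k u)

    tag-value : ∀ k (φ : Formula (k ℕ.+ n)) →
                ⟦ numeral {n} (tag φ) ⟧ ρ ≡ tag (sub (σ {m} k) φ)
    tag-value k φ = trans (value-numeral (tag φ)) (tag-sub φ)
      where
      tag-sub : ∀ ψ → tag ψ ≡ tag (sub (σ {m} k) ψ)
      tag-sub ⊥̇       = refl
      tag-sub (_ ≐ _) = refl
      tag-sub (_ ≤̇ _) = refl
      tag-sub (_ ⇒ _) = refl
      tag-sub (_ ∧ _) = refl
      tag-sub (_ ∨ _) = refl
      tag-sub (∀̇ _)   = refl
      tag-sub (∃̇ _)   = refl

    mutual
      gn-value : ∀ k φ → ⟦ gnᵈ k φ ⟧ ρ ≡ gn (sub (σ {m} k) φ)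
      gn-value k φ = cong₂ pair (tag-value k φ) (args-value k φ)

      args-value : ∀ k φ → ⟦ argsᵈ k φ ⟧ ρ ≡ args (sub (σ {m} k) φ)
      args-value k ⊥̇       = refl
      args-value k (t ≐ u) = cong₂ pair (gnₜ-value k t) (gnₜ-value k u)
      args-value k (t ≤̇ u) = cong₂ pair (gnₜ-value k t) (gnₜ-value k u)
      args-value k (φ ⇒ ψ) = cong₂ pair (gn-value k φ) (gn-value k ψ)
      args-value k (φ ∧ ψ) = cong₂ pair (gn-value k φ) (gn-value k ψ)
      args-value k (φ ∨ ψ) = cong₂ pair (gn-value k φ) (gn-value k ψ)
      args-value k (∀̇ φ)   = gn-value (suc k) φ
      args-value k (∃̇ φ)   = gn-value (suc k) φ

⌜⌝ᵈ-correct : (φ : Formula n) (ρ : Fin n → ℕ) →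
              ⟦ ⌜ φ ⌝ᵈ ⟧ ρ ≡ gn (sub {n = m} (numeral ∘ ρ) φ)
⌜⌝ᵈ-correct φ ρ = gn-value ρ 0 φ

-- Codes of partial recursive functions; f · xs ⇓ y says that f is defined
-- at xs with value y.
data Recursive : ℕ → Set where
  zer  : Recursive 0
  succ : Recursive 1
  proj : Fin n → Recursive n
  comp : Recursive m → (Fin m → Recursive n) → Recursive n
  prec : Recursive n → Recursive (suc (suc n)) → Recursive (suc n)
  mu   : Recursive (suc n) → Recursive n

infix 1 _·_⇓_

data _·_⇓_ : Recursive n → Vec ℕ n → ℕ → Set where
  zer⇓   : zer · [] ⇓ 0
  succ⇓  : ∀ {x} → succ · x ∷ [] ⇓ suc x
  proj⇓  : ∀ {xs : Vec ℕ n} i → proj i · xs ⇓ Vec.lookup xs i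
  comp⇓  : ∀ {f : Recursive m} {g : Fin m → Recursive n} {xs z} (ys : Vec ℕ m) →
           (∀ i → g i · xs ⇓ Vec.lookup ys i) → f · ys ⇓ z → comp f g · xs ⇓ z
  prec⇓0 : ∀ {f : Recursive n} {g xs z} → f · xs ⇓ z → prec f g · 0 ∷ xs ⇓ z
  prec⇓S : ∀ {f : Recursive n} {g xs x y z} →
           prec f g · x ∷ xs ⇓ y → g · x ∷ y ∷ xs ⇓ z → prec f g · suc x ∷ xs ⇓ z
  mu⇓    : ∀ {f : Recursive (suc n)} {xs y} → f · y ∷ xs ⇓ 0 →
           (∀ {x} → x ℕ.< y → ∃ λ z → f · x ∷ xs ⇓ suc z) → mu f · xs ⇓ y

-- A is the domain of a partial recursive function.
CE : (ℕ → Set) → Set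
CE A = Σ (Recursive 1) λ f → ∀ x → A x ⇔ (∃ λ y → f · x ∷ [] ⇓ y)

CETheory : Theory → Set
CETheory T = CE λ x → ∃ λ (φ : Sentence) → T φ × gn φ ≡ x

IsProvabilityPredicate : (S T : Theory) → Formula 1 → Set
IsProvabilityPredicate S T Pr = ∀ {n} (φ : Formula n) → (T ⊢ φ) ⇔ _⊢_ {n = 0} S (Pr ⟨ ⌜ φ ⌝ ⟩)

Eᵁ : (S T : Theory) → Formula 1 → Set
Eᵁ S T Pr = ∀ {n} (φ ψ : Formula n) →
  T ⊢ ∀* (φ ⇔̇ ψ) → S ⊢ ∀* (Pr ⟨ ⌜ φ ⌝ᵈ ⟩ ⇔̇ Pr ⟨ ⌜ ψ ⌝ᵈ ⟩)

CB∃ : (S : Theory) → Formula 1 → Set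
CB∃ S Pr = ∀ {n} (φ : Formula n) → S ⊢ ∃* (Pr ⟨ ⌜ φ ⌝ᵈ ⟩) ⇒ Pr ⟨ ⌜ ∃* φ ⌝ ⟩

Σ₁C : (S : Theory) → Formula 1 → Set
Σ₁C S Pr = (φ : Sentence) → Σ₁ φ → S ⊢ φ ⇒ Pr ⟨ ⌜ φ ⌝ ⟩

{-# OPTIONS --safe #-}
module Submission where

-- Write P φ for Pr(⌜φ(ẋ)⌝) and ITE φ A B for (φ ∧ A) ∨ (¬φ ∧ B).  For Δ₀ formulas φ and
-- arbitrary A, B we show
--     S ⊢ P (ITE φ A B) ↔ ITE φ (P A) (P B);
-- with A true and B false this gives S ⊢ φ → P φ, and CB∃ handles the existential
-- prefix.  Nothing lets us combine P φ and P ψ into P (φ ∧ ψ), but the arbitrary branches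
-- replace this: ITE (φ → ψ) A B is T-equivalent to ITE φ (ITE ψ A B) A, so Eᵁ reduces
-- connectives to their components.  The bounded ∀ is handled by induction in S on
-- the bound, and x = y, x ≤ y by double induction.  Compound terms in φ are first replaced
-- by the numerals of their values: S ⊢ P (χ(t)) ↔ (P χ)(t), by induction in S using
-- x + sy = sx + y and x·sy + z = x·y + (x + z).

open import Defs
open import Data.Bool using (Bool; true; false; if_then_else_; not) renaming (_∧_ to _&&_; _∨_ to _||_)
open import Data.Bool.Properties using (∧-conicalˡ; ∧-conicalʳ)
open import Data.Fin using (Fin; zero; suc; toℕ; splitAt; _↑ˡ_; _↑ʳ_)
open import Data.Fin.Properties using (splitAt-↑ˡ; splitAt-↑ʳ)
open import Data.List using (List; []; _∷_; map)
open import Data.List.Properties using (map-∘; map-cong)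
open import Data.List.Membership.Propositional.Properties using (∈-map⁺)
open import Data.List.Relation.Binary.Subset.Propositional using (_⊆_)
open import Data.List.Relation.Binary.Subset.Propositional.Properties using (map⁺; ∷⁺ʳ)
open import Data.List.Relation.Unary.Any using (here; there)
open import Data.Nat as ℕ using (ℕ; zero; suc)
open import Data.Nat.Properties using (+-comm; *-comm)
open import Data.Sum using (inj₁; inj₂; [_,_]′)
open import Data.Vec using (Vec; []; _∷_; lookup)
open import Function using (_∘_; id)
open import Function.Bundles using (Equivalence)
open import Relation.Binary.PropositionalEquality using (_≡_; refl; sym; trans; cong; cong₂; subst; subst₂; module ≡-Reasoning)

private
  variable
    k l m n : ℕ
    U : Theory
    Γ Δ : List (Formula n)

-- Substitution

infixr 5 _∷ₛ_

_∷ₛ_ : Term n → Sub m n → Sub (suc m) n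
(t ∷ₛ σ) zero    = t
(t ∷ₛ σ) (suc i) = σ i

[]ₛ : Sub 0 n
[]ₛ ()

-- Substitutions are functions, so equalities between them are kept pointwise; these congruences
-- take the place of function extensionality.
subₜ-cong : {σ τ : Sub m n} → (∀ i → σ i ≡ τ i) → ∀ t → subₜ σ t ≡ subₜ τ t
subₜ-cong e (var i) = e i
subₜ-cong e O       = refl
subₜ-cong e (s t)   = cong s (subₜ-cong e t)
subₜ-cong e (t ⊕ u) = cong₂ _⊕_ (subₜ-cong e t) (subₜ-cong e u)
subₜ-cong e (t ⊗ u) = cong₂ _⊗_ (subₜ-cong e t) (subₜ-cong e u)

lift-cong : {σ τ : Sub m n} → (∀ i → σ i ≡ τ i) → ∀ i → lift σ i ≡ lift τ i
lift-cong e zero    = refl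
lift-cong e (suc i) = cong wkₜ (e i)

sub-cong : {σ τ : Sub m n} → (∀ i → σ i ≡ τ i) → ∀ φ → sub σ φ ≡ sub τ φ
sub-cong e ⊥̇       = refl
sub-cong e (t ≐ u) = cong₂ _≐_ (subₜ-cong e t) (subₜ-cong e u)
sub-cong e (t ≤̇ u) = cong₂ _≤̇_ (subₜ-cong e t) (subₜ-cong e u)
sub-cong e (φ ⇒ ψ) = cong₂ _⇒_ (sub-cong e φ) (sub-cong e ψ)
sub-cong e (φ ∧ ψ) = cong₂ _∧_ (sub-cong e φ) (sub-cong e ψ)
sub-cong e (φ ∨ ψ) = cong₂ _∨_ (sub-cong e φ) (sub-cong e ψ)
sub-cong e (∀̇ φ)   = cong ∀̇_ (sub-cong (lift-cong e) φ)
sub-cong e (∃̇ φ)   = cong ∃̇_ (sub-cong (lift-cong e) φ)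

-- Once renamings are substitutions, the composition laws `subₜ-subₜ` and `sub-sub` also cover the
-- mixed cases.
renₜ-as-subₜ : (ρ : Ren m n) → ∀ t → renₜ ρ t ≡ subₜ (var ∘ ρ) t
renₜ-as-subₜ ρ (var i) = refl
renₜ-as-subₜ ρ O       = refl
renₜ-as-subₜ ρ (s t)   = cong s (renₜ-as-subₜ ρ t)
renₜ-as-subₜ ρ (t ⊕ u) = cong₂ _⊕_ (renₜ-as-subₜ ρ t) (renₜ-as-subₜ ρ u)
renₜ-as-subₜ ρ (t ⊗ u) = cong₂ _⊗_ (renₜ-as-subₜ ρ t) (renₜ-as-subₜ ρ u)

lift-var : (ρ : Ren m n) → ∀ i → var (liftᵣ ρ i) ≡ lift (var ∘ ρ) i
lift-var ρ zero    = refl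
lift-var ρ (suc i) = refl

ren-as-sub : (ρ : Ren m n) → ∀ φ → ren ρ φ ≡ sub (var ∘ ρ) φ
ren-as-sub ρ ⊥̇       = refl
ren-as-sub ρ (t ≐ u) = cong₂ _≐_ (renₜ-as-subₜ ρ t) (renₜ-as-subₜ ρ u)
ren-as-sub ρ (t ≤̇ u) = cong₂ _≤̇_ (renₜ-as-subₜ ρ t) (renₜ-as-subₜ ρ u)
ren-as-sub ρ (φ ⇒ ψ) = cong₂ _⇒_ (ren-as-sub ρ φ) (ren-as-sub ρ ψ)
ren-as-sub ρ (φ ∧ ψ) = cong₂ _∧_ (ren-as-sub ρ φ) (ren-as-sub ρ ψ)
ren-as-sub ρ (φ ∨ ψ) = cong₂ _∨_ (ren-as-sub ρ φ) (ren-as-sub ρ ψ)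
ren-as-sub ρ (∀̇ φ)   = cong ∀̇_ (trans (ren-as-sub (liftᵣ ρ) φ) (sub-cong (lift-var ρ) φ))
ren-as-sub ρ (∃̇ φ)   = cong ∃̇_ (trans (ren-as-sub (liftᵣ ρ) φ) (sub-cong (lift-var ρ) φ))

subₜ-subₜ : (σ : Sub l m) (τ : Sub m n) → ∀ t → subₜ τ (subₜ σ t) ≡ subₜ (subₜ τ ∘ σ) t
subₜ-subₜ σ τ (var i) = refl
subₜ-subₜ σ τ O       = refl
subₜ-subₜ σ τ (s t)   = cong s (subₜ-subₜ σ τ t)
subₜ-subₜ σ τ (t ⊕ u) = cong₂ _⊕_ (subₜ-subₜ σ τ t) (subₜ-subₜ σ τ u)
subₜ-subₜ σ τ (t ⊗ u) = cong₂ _⊗_ (subₜ-subₜ σ τ t) (subₜ-subₜ σ τ u)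

subₜ-renₜ : (ρ : Ren l m) (τ : Sub m n) → ∀ t → subₜ τ (renₜ ρ t) ≡ subₜ (τ ∘ ρ) t
subₜ-renₜ ρ τ t = trans (cong (subₜ τ) (renₜ-as-subₜ ρ t)) (subₜ-subₜ (var ∘ ρ) τ t)

lift-wkₜ : (τ : Sub m n) → ∀ t → subₜ (lift τ) (wkₜ t) ≡ wkₜ (subₜ τ t)
lift-wkₜ τ t = begin
  subₜ (lift τ) (wkₜ t)          ≡⟨ subₜ-renₜ suc (lift τ) t ⟩
  subₜ (wkₜ ∘ τ) t               ≡⟨ subₜ-cong (λ i → renₜ-as-subₜ suc (τ i)) t ⟩
  subₜ (subₜ (var ∘ suc) ∘ τ) t  ≡⟨ subₜ-subₜ τ (var ∘ suc) t ⟨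
  subₜ (var ∘ suc) (subₜ τ t)    ≡⟨ renₜ-as-subₜ suc (subₜ τ t) ⟨
  wkₜ (subₜ τ t)                 ∎
  where open ≡-Reasoning

lift-∘ : (σ : Sub l m) (τ : Sub m n) → ∀ i → subₜ (lift τ) (lift σ i) ≡ lift (subₜ τ ∘ σ) i
lift-∘ σ τ zero    = refl
lift-∘ σ τ (suc i) = lift-wkₜ τ (σ i)

sub-sub : (σ : Sub l m) (τ : Sub m n) → ∀ φ → sub τ (sub σ φ) ≡ sub (subₜ τ ∘ σ) φ
sub-sub σ τ ⊥̇       = refl
sub-sub σ τ (t ≐ u) = cong₂ _≐_ (subₜ-subₜ σ τ t) (subₜ-subₜ σ τ u)
sub-sub σ τ (t ≤̇ u) = cong₂ _≤̇_ (subₜ-subₜ σ τ t) (subₜ-subₜ σ τ u)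
sub-sub σ τ (φ ⇒ ψ) = cong₂ _⇒_ (sub-sub σ τ φ) (sub-sub σ τ ψ)
sub-sub σ τ (φ ∧ ψ) = cong₂ _∧_ (sub-sub σ τ φ) (sub-sub σ τ ψ)
sub-sub σ τ (φ ∨ ψ) = cong₂ _∨_ (sub-sub σ τ φ) (sub-sub σ τ ψ)
sub-sub σ τ (∀̇ φ)   = cong ∀̇_ (trans (sub-sub (lift σ) (lift τ) φ) (sub-cong (lift-∘ σ τ) φ))
sub-sub σ τ (∃̇ φ)   = cong ∃̇_ (trans (sub-sub (lift σ) (lift τ) φ) (sub-cong (lift-∘ σ τ) φ))

subₜ-var : (t : Term n) → subₜ var t ≡ t
subₜ-var (var i) = refl
subₜ-var O       = refl
subₜ-var (s t)   = cong s (subₜ-var t)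
subₜ-var (t ⊕ u) = cong₂ _⊕_ (subₜ-var t) (subₜ-var u)
subₜ-var (t ⊗ u) = cong₂ _⊗_ (subₜ-var t) (subₜ-var u)

lift-id : ∀ i → lift (var {n}) i ≡ var i
lift-id zero    = refl
lift-id (suc i) = refl

sub-var : (φ : Formula n) → sub var φ ≡ φ
sub-var ⊥̇       = refl
sub-var (t ≐ u) = cong₂ _≐_ (subₜ-var t) (subₜ-var u)
sub-var (t ≤̇ u) = cong₂ _≤̇_ (subₜ-var t) (subₜ-var u)
sub-var (φ ⇒ ψ) = cong₂ _⇒_ (sub-var φ) (sub-var ψ)
sub-var (φ ∧ ψ) = cong₂ _∧_ (sub-var φ) (sub-var ψ)
sub-var (φ ∨ ψ) = cong₂ _∨_ (sub-var φ) (sub-var ψ)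
sub-var (∀̇ φ)   = cong ∀̇_ (trans (sub-cong lift-id φ) (sub-var φ))
sub-var (∃̇ φ)   = cong ∃̇_ (trans (sub-cong lift-id φ) (sub-var φ))

sub-≡var : {σ : Sub n n} → (∀ i → σ i ≡ var i) → ∀ φ → sub σ φ ≡ φ
sub-≡var e φ = trans (sub-cong e φ) (sub-var φ)

sub-ren : (ρ : Ren l m) (τ : Sub m n) → ∀ φ → sub τ (ren ρ φ) ≡ sub (τ ∘ ρ) φ
sub-ren ρ τ φ = trans (cong (sub τ) (ren-as-sub ρ φ)) (sub-sub (var ∘ ρ) τ φ)

single-wkₜ : (t u : Term n) → subₜ (single u) (wkₜ t) ≡ t
single-wkₜ t u = trans (subₜ-renₜ suc (single u) t) (subₜ-var t)

lift-wk : (τ : Sub m n) → ∀ φ → sub (lift τ) (wk φ) ≡ wk (sub τ φ)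
lift-wk τ φ = begin
  sub (lift τ) (wk φ)           ≡⟨ sub-ren suc (lift τ) φ ⟩
  sub (wkₜ ∘ τ) φ               ≡⟨ sub-cong (λ i → renₜ-as-subₜ suc (τ i)) φ ⟩
  sub (subₜ (var ∘ suc) ∘ τ) φ  ≡⟨ sub-sub τ (var ∘ suc) φ ⟨
  sub (var ∘ suc) (sub τ φ)     ≡⟨ ren-as-sub suc (sub τ φ) ⟨
  wk (sub τ φ)                  ∎
  where open ≡-Reasoning

sub-[] : (σ : Sub m n) (φ : Formula (suc m)) (t : Term m) →
         sub σ (φ [ t ]) ≡ sub (lift σ) φ [ subₜ σ t ]
sub-[] σ φ t = begin
  sub σ (φ [ t ])                                 ≡⟨ sub-sub (single t) σ φ ⟩
  sub (subₜ σ ∘ single t) φ                       ≡⟨ sub-cong e φ ⟩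
  sub (subₜ (single (subₜ σ t)) ∘ lift σ) φ       ≡⟨ sub-sub (lift σ) (single (subₜ σ t)) φ ⟨
  sub (lift σ) φ [ subₜ σ t ]                     ∎
  where
  open ≡-Reasoning
  e : ∀ i → subₜ σ (single t i) ≡ subₜ (single (subₜ σ t)) (lift σ i)
  e zero    = refl
  e (suc i) = sym (single-wkₜ (σ i) (subₜ σ t))

sub-embed : (σ : Sub m n) → ∀ φ → sub σ (embed φ) ≡ embed φ
sub-embed σ φ = trans (sub-ren (λ ()) σ φ) (trans (sub-cong (λ ()) φ) (sym (ren-as-sub (λ ()) φ)))

embed-id : (φ : Sentence) → embed φ ≡ φ
embed-id φ = trans (ren-as-sub (λ ()) φ) (sub-≡var (λ ()) φ)

-- Structural properties of derivations

weaken : ∀ {φ} → Γ ⊆ Δ → U ∣ Γ ⊩ φ → U ∣ Δ ⊩ φ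
weaken ι (axiom a)  = axiom a
weaken ι (hyp x)    = hyp (ι x)
weaken ι (raa d)    = raa (weaken (∷⁺ʳ _ ι) d)
weaken ι (⇒I d)     = ⇒I (weaken (∷⁺ʳ _ ι) d)
weaken ι (⇒E d e)   = ⇒E (weaken ι d) (weaken ι e)
weaken ι (∧I d e)   = ∧I (weaken ι d) (weaken ι e)
weaken ι (∧E₁ d)    = ∧E₁ (weaken ι d)
weaken ι (∧E₂ d)    = ∧E₂ (weaken ι d)
weaken ι (∨I₁ d)    = ∨I₁ (weaken ι d)
weaken ι (∨I₂ d)    = ∨I₂ (weaken ι d)
weaken ι (∨E d e f) = ∨E (weaken ι d) (weaken (∷⁺ʳ _ ι) e) (weaken (∷⁺ʳ _ ι) f)
weaken ι (∀I d)     = ∀I (weaken (map⁺ wk ι) d)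
weaken ι (∀E t d)   = ∀E t (weaken ι d)
weaken ι (∃I t d)   = ∃I t (weaken ι d)
weaken ι (∃E d e)   = ∃E (weaken ι d) (weaken (∷⁺ʳ _ (map⁺ wk ι)) e)
weaken ι (≐I t)     = ≐I t
weaken ι (≐E φ d e) = ≐E φ (weaken ι d) (weaken ι e)

thm : ∀ {φ} → U ⊢ φ → U ∣ Γ ⊩ φ
thm = weaken λ ()

cast : ∀ {φ ψ} → φ ≡ ψ → U ∣ Γ ⊩ φ → U ∣ Γ ⊩ ψ
cast {U} {Γ = Γ} = subst (U ∣ Γ ⊩_)

map-lift-wk : (σ : Sub m n) → ∀ Γ → map (sub (lift σ)) (map wk Γ) ≡ map wk (map (sub σ) Γ)
map-lift-wk σ Γ = trans (sym (map-∘ Γ)) (trans (map-cong (lift-wk σ) Γ) (map-∘ Γ))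

substitute : ∀ {φ} (σ : Sub m n) → U ∣ Γ ⊩ φ → U ∣ map (sub σ) Γ ⊩ sub σ φ
substitute σ (axiom {a} x) = cast (sym (sub-embed σ a)) (axiom x)
substitute σ (hyp x)       = hyp (∈-map⁺ (sub σ) x)
substitute σ (raa d)       = raa (substitute σ d)
substitute σ (⇒I d)        = ⇒I (substitute σ d)
substitute σ (⇒E d e)      = ⇒E (substitute σ d) (substitute σ e)
substitute σ (∧I d e)      = ∧I (substitute σ d) (substitute σ e)
substitute σ (∧E₁ d)       = ∧E₁ (substitute σ d)
substitute σ (∧E₂ d)       = ∧E₂ (substitute σ d)
substitute σ (∨I₁ d)       = ∨I₁ (substitute σ d)
substitute σ (∨I₂ d)       = ∨I₂ (substitute σ d)
substitute σ (∨E d e f)    = ∨E (substitute σ d) (substitute σ e) (substitute σ f)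
substitute {U = U} {Γ = Γ} σ (∀I d) =
  ∀I (subst (U ∣_⊩ _) (map-lift-wk σ Γ) (substitute (lift σ) d))
substitute σ (∀E {φ} t d)  = cast (sym (sub-[] σ φ t)) (∀E (subₜ σ t) (substitute σ d))
substitute σ (∃I {φ} t d)  = ∃I (subₜ σ t) (cast (sub-[] σ φ t) (substitute σ d))
substitute {U = U} {Γ = Γ} σ (∃E {φ} {χ} d e) =
  ∃E (substitute σ d)
     (subst₂ (λ Δ ψ → U ∣ sub (lift σ) φ ∷ Δ ⊩ ψ) (map-lift-wk σ Γ) (lift-wk σ χ)
       (substitute (lift σ) e))
substitute σ (≐I t)        = ≐I (subₜ σ t)
substitute σ (≐E φ {t} {u} d e) =
  cast (sym (sub-[] σ φ u))
    (≐E (sub (lift σ) φ) (substitute σ d) (cast (sub-[] σ φ t) (substitute σ e)))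

inst : ∀ {φ} (σ : Sub m n) → U ⊢ φ → U ∣ Γ ⊩ sub σ φ
inst σ d = thm (substitute σ d)

∀*I : {φ : Formula n} → U ⊢ φ → U ⊢ ∀* φ
∀*I {zero}  d = d
∀*I {suc n} d = ∀*I (∀I d)

-- The derivation is first shifted past a fresh `x₀`; instantiating at that variable restores the
-- original indices.
∀-open : {φ : Formula (suc n)} → U ⊢ ∀̇ φ → U ⊢ φ
∀-open {φ = φ} d = cast e (∀E (var zero) (inst (var ∘ suc) d))
  where
  e : sub (lift (var ∘ suc)) φ [ var zero ] ≡ φ
  e = trans (sub-sub (lift (var ∘ suc)) (single (var zero)) φ)
            (sub-≡var (λ { zero → refl ; (suc i) → refl }) φ)

∀*E : {φ : Formula n} → U ⊢ ∀* φ → U ⊢ φ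
∀*E {zero}  d = d
∀*E {suc n} d = ∀-open (∀*E d)

wk-∀E : {φ : Formula (suc n)} → U ∣ Γ ⊩ wk (∀̇ φ) → U ∣ Γ ⊩ φ
wk-∀E {φ = φ} d = cast (trans (sub-ren (liftᵣ suc) (single (var zero)) φ)
  (sub-≡var (λ { zero → refl ; (suc i) → refl }) φ)) (∀E (var zero) d)

∃*-mono : {φ ψ : Formula n} → U ⊢ φ ⇒ ψ → U ⊢ ∃* φ ⇒ ∃* ψ
∃*-mono {zero}  d = d
∃*-mono {suc n} {φ = φ} {ψ} d = ∃*-mono (⇒I (∃E (hyp (here refl))
  (∃I (var zero) (cast (sym e) (⇒E (thm d) (hyp (here refl)))))))
  where
  e : ren (liftᵣ suc) ψ [ var zero ] ≡ ψ
  e = trans (sub-ren (liftᵣ suc) (single (var zero)) ψ)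
            (sub-≡var (λ { zero → refl ; (suc i) → refl }) ψ)

-- Propositional tautologies

data Schema (k : ℕ) : Set where
  atom : Fin k → Schema k
  ff   : Schema k
  _⟶_ _&_ _∥_ : Schema k → Schema k → Schema k

infixr 3 _⟶_
infixr 5 _&_
infixr 4 _∥_

instantiate : Schema k → Vec (Formula n) k → Formula n
instantiate (atom i) v = lookup v i
instantiate ff       v = ⊥̇
instantiate (a ⟶ b)  v = instantiate a v ⇒ instantiate b v
instantiate (a & b)  v = instantiate a v ∧ instantiate b v
instantiate (a ∥ b)  v = instantiate a v ∨ instantiate b v

eval : Schema k → Vec Bool k → Bool
eval (atom i) e = lookup e i
eval ff       e = false
eval (a ⟶ b)  e = not (eval a e) || eval b e
eval (a & b)  e = eval a e && eval b e
eval (a ∥ b)  e = eval a e || eval b e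

valid : (Vec Bool k → Bool) → Bool
valid {zero}  f = f []
valid {suc k} f = valid (f ∘ (true ∷_)) && valid (f ∘ (false ∷_))

valid-sound : (f : Vec Bool k → Bool) → valid f ≡ true → ∀ e → f e ≡ true
valid-sound f p []          = p
valid-sound f p (true  ∷ e) = valid-sound (f ∘ (true ∷_)) (∧-conicalˡ _ _ p) e
valid-sound f p (false ∷ e) = valid-sound (f ∘ (false ∷_)) (∧-conicalʳ (valid (f ∘ (true ∷_))) _ p) e

literal : Bool → Formula n → Formula n
literal b φ = if b then φ else ¬̇ φ

⊥E : ∀ {φ} → U ∣ Γ ⊩ ⊥̇ → U ∣ Γ ⊩ φ
⊥E d = raa (weaken there d)

kalmár : (a : Schema k) (v : Vec (Formula n) k) (e : Vec Bool k) →
         (∀ i → U ∣ Γ ⊩ literal (lookup e i) (lookup v i)) →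
         U ∣ Γ ⊩ literal (eval a e) (instantiate a v)
kalmár (atom i) v e h = h i
kalmár ff       v e h = ⇒I (hyp (here refl))
kalmár (a ⟶ b)  v e h with eval a e | kalmár a v e h | eval b e | kalmár b v e h
... | false | p | _     | q = ⇒I (⊥E (⇒E (weaken there p) (hyp (here refl))))
... | true  | p | true  | q = ⇒I (weaken there q)
... | true  | p | false | q = ⇒I (⇒E (weaken there q) (⇒E (hyp (here refl)) (weaken there p)))
kalmár (a & b)  v e h with eval a e | kalmár a v e h | eval b e | kalmár b v e h
... | false | p | _     | q = ⇒I (⇒E (weaken there p) (∧E₁ (hyp (here refl))))
... | true  | p | true  | q = ∧I p q
... | true  | p | false | q = ⇒I (⇒E (weaken there q) (∧E₂ (hyp (here refl))))
kalmár (a ∥ b)  v e h with eval a e | kalmár a v e h | eval b e | kalmár b v e h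
... | true  | p | _     | q = ∨I₁ p
... | false | p | true  | q = ∨I₂ q
... | false | p | false | q = ⇒I (∨E (hyp (here refl))
  (⇒E (weaken (there ∘ there) p) (hyp (here refl)))
  (⇒E (weaken (there ∘ there) q) (hyp (here refl))))

by-cases : ∀ φ {χ : Formula n} → U ∣ φ ∷ Γ ⊩ χ → U ∣ ¬̇ φ ∷ Γ ⊩ χ → U ∣ Γ ⊩ χ
by-cases φ d e = raa (⇒E (hyp (here refl)) (⇒E (weaken there (⇒I e))
  (⇒I (⇒E (hyp (there (here refl))) (⇒E (weaken (there ∘ there) (⇒I d)) (hyp (here refl)))))))

-- The context `Δ` in the premise is arbitrary because every case distinction adds a literal to it.
split-literals : (v : Vec (Formula n) k) {χ : Formula n} →
  (∀ {Δ} e → (∀ i → U ∣ Δ ⊩ literal (lookup e i) (lookup v i)) → U ∣ Δ ⊩ χ) → U ∣ Γ ⊩ χ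
split-literals []      h = h [] λ ()
split-literals (φ ∷ v) h = by-cases φ
  (⇒E (split-literals v λ e p → ⇒I (h (true ∷ e)
    λ { zero → hyp (here refl) ; (suc i) → weaken there (p i) })) (hyp (here refl)))
  (⇒E (split-literals v λ e p → ⇒I (h (false ∷ e)
    λ { zero → hyp (here refl) ; (suc i) → weaken there (p i) })) (hyp (here refl)))

-- Completeness by reflection: with `refl` for the last argument the type checker evaluates the
-- schema under all valuations, `kalmár` turns each valuation into a derivation from literals, and
-- `split-literals` discharges the literals.
taut : (a : Schema k) (v : Vec (Formula n) k) → valid (eval a) ≡ true → U ∣ Γ ⊩ instantiate a v
taut a v p = split-literals v λ e h →
  subst (λ b → _ ∣ _ ⊩ literal b (instantiate a v)) (valid-sound (eval a) p e) (kalmár a v e h)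

infix 2 _⟷_

_⟷_ : Schema k → Schema k → Schema k
a ⟷ b = (a ⟶ b) & (b ⟶ a)

a₀ : Schema (1 ℕ.+ k)
a₀ = atom zero

a₁ : Schema (2 ℕ.+ k)
a₁ = atom (suc zero)

a₂ : Schema (3 ℕ.+ k)
a₂ = atom (suc (suc zero))

a₃ : Schema (4 ℕ.+ k)
a₃ = atom (suc (suc (suc zero)))

a₄ : Schema (5 ℕ.+ k)
a₄ = atom (suc (suc (suc (suc zero))))

a₅ : Schema (6 ℕ.+ k)
a₅ = atom (suc (suc (suc (suc (suc zero)))))

a₆ : Schema (7 ℕ.+ k)
a₆ = atom (suc (suc (suc (suc (suc (suc zero))))))

a₇ : Schema (8 ℕ.+ k)
a₇ = atom (suc (suc (suc (suc (suc (suc (suc zero)))))))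

⇔-refl : {φ : Formula n} → U ∣ Γ ⊩ φ ⇔̇ φ
⇔-refl {φ = φ} = taut (a₀ ⟷ a₀) (φ ∷ []) refl

-- Equality

x₀ : Term (1 ℕ.+ n)
x₀ = var zero

x₁ : Term (2 ℕ.+ n)
x₁ = var (suc zero)

x₂ : Term (3 ℕ.+ n)
x₂ = var (suc (suc zero))

x₃ : Term (4 ℕ.+ n)
x₃ = var (suc (suc (suc zero)))

-- The rule `≐E` is applied to variables only, where its substitutions compute; arbitrary terms
-- enter afterwards through `inst`. The same device is used for the laws of arithmetic.
≐-sym : {t u : Term n} → U ∣ Γ ⊩ t ≐ u → U ∣ Γ ⊩ u ≐ t
≐-sym {U = U} {t = t} {u} d = ⇒E (inst (t ∷ₛ u ∷ₛ []ₛ) open-sym) d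
  where
  open-sym : U ⊢ x₀ ≐ x₁ ⇒ x₁ ≐ x₀
  open-sym = ⇒I (≐E (x₀ ≐ x₁) (hyp (here refl)) (≐I x₀))

≐-trans : {t u v : Term n} → U ∣ Γ ⊩ t ≐ u → U ∣ Γ ⊩ u ≐ v → U ∣ Γ ⊩ t ≐ v
≐-trans {U = U} {t = t} {u} {v} d e = ⇒E (⇒E (inst (t ∷ₛ u ∷ₛ v ∷ₛ []ₛ) open-trans) d) e
  where
  open-trans : U ⊢ x₀ ≐ x₁ ⇒ x₁ ≐ x₂ ⇒ x₀ ≐ x₂
  open-trans = ⇒I (⇒I (≐E (x₁ ≐ x₀) (hyp (here refl)) (hyp (there (here refl)))))

s-cong : {t u : Term n} → U ∣ Γ ⊩ t ≐ u → U ∣ Γ ⊩ s t ≐ s u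
s-cong {U = U} {t = t} {u} d = ⇒E (inst (t ∷ₛ u ∷ₛ []ₛ) open-cong) d
  where
  open-cong : U ⊢ x₀ ≐ x₁ ⇒ s x₀ ≐ s x₁
  open-cong = ⇒I (≐E (s x₁ ≐ s x₀) (hyp (here refl)) (≐I (s x₀)))

⊕-cong : {t t′ u u′ : Term n} → U ∣ Γ ⊩ t ≐ t′ → U ∣ Γ ⊩ u ≐ u′ → U ∣ Γ ⊩ t ⊕ u ≐ t′ ⊕ u′
⊕-cong {U = U} {t = t} {t′} {u} {u′} d e =
  ⇒E (⇒E (inst (t ∷ₛ t′ ∷ₛ u ∷ₛ u′ ∷ₛ []ₛ) open-cong) d) e
  where
  open-cong : U ⊢ x₀ ≐ x₁ ⇒ x₂ ≐ x₃ ⇒ x₀ ⊕ x₂ ≐ x₁ ⊕ x₃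
  open-cong = ⇒I (⇒I (≐E (x₁ ⊕ x₃ ≐ x₂ ⊕ x₀) (hyp (here refl))
    (≐E (x₁ ⊕ x₃ ≐ x₀ ⊕ x₃) (hyp (there (here refl))) (≐I (x₀ ⊕ x₂)))))

⊗-cong : {t t′ u u′ : Term n} → U ∣ Γ ⊩ t ≐ t′ → U ∣ Γ ⊩ u ≐ u′ → U ∣ Γ ⊩ t ⊗ u ≐ t′ ⊗ u′
⊗-cong {U = U} {t = t} {t′} {u} {u′} d e =
  ⇒E (⇒E (inst (t ∷ₛ t′ ∷ₛ u ∷ₛ u′ ∷ₛ []ₛ) open-cong) d) e
  where
  open-cong : U ⊢ x₀ ≐ x₁ ⇒ x₂ ≐ x₃ ⇒ x₀ ⊗ x₂ ≐ x₁ ⊗ x₃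
  open-cong = ⇒I (⇒I (≐E (x₁ ⊗ x₃ ≐ x₂ ⊗ x₀) (hyp (here refl))
    (≐E (x₁ ⊗ x₃ ≐ x₀ ⊗ x₃) (hyp (there (here refl))) (≐I (x₀ ⊗ x₂)))))

sub-≐ : (χ : Formula (suc m)) (σ : Sub m n) {t u : Term n} →
        U ∣ Γ ⊩ t ≐ u → U ∣ Γ ⊩ sub (t ∷ₛ σ) χ ⇒ sub (u ∷ₛ σ) χ
sub-≐ {m} {n} χ σ {t} {u} d =
  ⇒I (cast (e u) (≐E (sub (lift σ) χ) (weaken there d) (cast (sym (e t)) (hyp (here refl)))))
  where
  e : (v : Term n) → sub (lift σ) χ [ v ] ≡ sub (v ∷ₛ σ) χ
  e v = trans (sub-sub (lift σ) (single v) χ)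
          (sub-cong (λ { zero → refl ; (suc i) → single-wkₜ (σ i) v }) χ)

sub-≐⇔ : (χ : Formula (suc m)) (σ : Sub m n) {t u : Term n} →
         U ∣ Γ ⊩ t ≐ u → U ∣ Γ ⊩ sub (t ∷ₛ σ) χ ⇔̇ sub (u ∷ₛ σ) χ
sub-≐⇔ χ σ d = ∧I (sub-≐ χ σ d) (sub-≐ χ σ (≐-sym d))

-- Arithmetic

x₊ : Sub n (suc n)
x₊ i = var (suc i)

x₊₊ : Sub n (2 ℕ.+ n)
x₊₊ i = var (suc (suc i))

module Induction {U : Theory} (ext : U Extends PA) where

  -- The axiom scheme as a rule for open formulas. Writing the substitutions as explicit lists lets
  -- concrete instances compute; the casts lead back to `_[_]` and `step`.
  induction : (φ : Formula (suc n)) →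
              U ⊢ sub (O ∷ₛ var) φ → U ⊢ φ ⇒ sub (s x₀ ∷ₛ x₊) φ → U ⊢ φ
  induction φ z d = ∀-open (⇒E (∀*E (ext _ (cast (embed-id _) (axiom (ind φ)))))
    (∧I (cast (sub-cong (λ { zero → refl ; (suc i) → refl }) φ) z)
        (∀I (cast (cong (φ ⇒_) (sub-cong (λ { zero → refl ; (suc i) → refl }) φ)) d))))

  case-zero-suc : (φ : Formula (suc n)) →
                  U ⊢ sub (O ∷ₛ var) φ → U ⊢ sub (s x₀ ∷ₛ x₊) φ → U ⊢ φ
  case-zero-suc φ z d = induction φ z (⇒I (thm d))

  -- Induction on x₁, with the induction hypothesis generalised over x₀.
  induction∀ : (φ : Formula (2 ℕ.+ n)) →
               U ⊢ sub (x₀ ∷ₛ O ∷ₛ x₊) φ → U ⊢ wk (∀̇ φ) ⇒ sub (x₀ ∷ₛ s x₁ ∷ₛ x₊₊) φ → U ⊢ φ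
  induction∀ φ z d = ∀-open (induction (∀̇ φ)
    (∀I (cast (sub-cong (λ { zero → refl ; (suc zero) → refl ; (suc (suc i)) → refl }) φ) z))
    (⇒I (∀I (⇒E (thm (cast (cong (wk (∀̇ φ) ⇒_)
      (sub-cong (λ { zero → refl ; (suc zero) → refl ; (suc (suc i)) → refl }) φ)) d))
      (hyp (here refl))))))

  ∀-inst : (φ : Formula (2 ℕ.+ n)) (t : Term (2 ℕ.+ n)) →
           U ∣ Γ ⊩ wk (∀̇ φ) → U ∣ Γ ⊩ sub (t ∷ₛ x₁ ∷ₛ x₊₊) φ
  ∀-inst φ t d = cast (trans (sub-ren (liftᵣ suc) (single t) φ)
    (sub-cong (λ { zero → refl ; (suc zero) → refl ; (suc (suc i)) → refl }) φ)) (∀E t d)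

  -- The outer induction is on `x₁`, with the hypothesis generalised over `x₀`. Inside it a case
  -- distinction on `x₀` suffices: for a successor the hypothesis is used at the predecessor.
  double-induction : (φ : Formula (2 ℕ.+ n)) →
    U ⊢ sub (O ∷ₛ O ∷ₛ var) φ → U ⊢ sub (O ∷ₛ s x₀ ∷ₛ x₊) φ →
    U ⊢ sub (s x₀ ∷ₛ O ∷ₛ x₊) φ → U ⊢ φ ⇒ sub (s x₀ ∷ₛ s x₁ ∷ₛ x₊₊) φ → U ⊢ φ
  double-induction {n} φ z₀₀ z₀₁ z₁₀ d = induction∀ φ
    (case-zero-suc _ (cast (sym (f _ _ φ λ { zero → refl ; (suc zero) → refl ; (suc (suc i)) → refl })) z₀₀)
                     (cast (sym (f _ _ φ λ { zero → refl ; (suc zero) → refl ; (suc (suc i)) → refl })) z₁₀))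
    (case-zero-suc _
      (⇒I (thm (cast (sym (f _ _ φ λ { zero → refl ; (suc zero) → refl ; (suc (suc i)) → refl })) z₀₁)))
      (⇒I (cast (sym (f _ _ φ λ { zero → refl ; (suc zero) → refl ; (suc (suc i)) → refl }))
        (⇒E (thm d) (cast (sub-≡var (λ { zero → refl ; (suc zero) → refl ; (suc (suc i)) → refl }) φ)
          (∀-inst φ x₀ (cast g (hyp (here refl)))))))))
    where
    f : ∀ {k l m} (σ : Sub k l) (τ : Sub l m) {υ : Sub k m} (χ : Formula k) →
        (∀ i → subₜ τ (σ i) ≡ υ i) → sub τ (sub σ χ) ≡ sub υ χ
    f σ τ χ e = trans (sub-sub σ τ χ) (sub-cong e χ)
    -- The generalised hypothesis does not mention the variable on which the case distinction is
    -- made, so it survives that substitution.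
    g : sub (s x₀ ∷ₛ x₊) (wk (∀̇ φ)) ≡ wk (∀̇ φ)
    g = trans (sub-ren suc (s x₀ ∷ₛ x₊) (∀̇ φ)) (sym (ren-as-sub suc (∀̇ φ)))

-- These facts are derived in `PA` itself because they serve on both sides of the provability
-- predicate: in `T` for formulas inside a code, and in `S` outside it.
module Peano where

  open Induction {PA} (λ _ → id) public

  ⊕-O : (t : Term n) → PA ∣ Γ ⊩ t ⊕ O ≐ t
  ⊕-O t = inst (t ∷ₛ []ₛ) (∀-open (axiom +-O))

  ⊕-s : (t u : Term n) → PA ∣ Γ ⊩ t ⊕ s u ≐ s (t ⊕ u)
  ⊕-s t u = inst (u ∷ₛ t ∷ₛ []ₛ) (∀-open (∀-open (axiom +-S)))

  ⊗-O : (t : Term n) → PA ∣ Γ ⊩ t ⊗ O ≐ O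
  ⊗-O t = inst (t ∷ₛ []ₛ) (∀-open (axiom *-O))

  ⊗-s : (t u : Term n) → PA ∣ Γ ⊩ t ⊗ s u ≐ t ⊗ u ⊕ t
  ⊗-s t u = inst (u ∷ₛ t ∷ₛ []ₛ) (∀-open (∀-open (axiom *-S)))

  s≢O : (t : Term n) → PA ∣ Γ ⊩ ¬̇ (s t ≐ O)
  s≢O t = inst (t ∷ₛ []ₛ) (∀-open (axiom S≢0))

  s-injective : {t u : Term n} → PA ∣ Γ ⊩ s t ≐ s u → PA ∣ Γ ⊩ t ≐ u
  s-injective {t = t} {u} d = ⇒E (inst (u ∷ₛ t ∷ₛ []ₛ) (∀-open (∀-open (axiom S-inj)))) d

  O-⊕ : (t : Term n) → PA ∣ Γ ⊩ O ⊕ t ≐ t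
  O-⊕ t = inst (t ∷ₛ []ₛ) (induction (O ⊕ x₀ ≐ x₀) (⊕-O O)
    (⇒I (≐-trans (⊕-s O x₀) (s-cong (hyp (here refl))))))

  s-⊕ : (t u : Term n) → PA ∣ Γ ⊩ s t ⊕ u ≐ s (t ⊕ u)
  s-⊕ t u = inst (u ∷ₛ t ∷ₛ []ₛ) (induction (s x₁ ⊕ x₀ ≐ s (x₁ ⊕ x₀))
    (≐-trans (⊕-O (s x₀)) (s-cong (≐-sym (⊕-O x₀))))
    (⇒I (≐-trans (⊕-s (s x₁) x₀) (s-cong (≐-trans (hyp (here refl)) (≐-sym (⊕-s x₁ x₀)))))))

  ⊕-assoc : (t u v : Term n) → PA ∣ Γ ⊩ (t ⊕ u) ⊕ v ≐ t ⊕ (u ⊕ v)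
  ⊕-assoc t u v = inst (v ∷ₛ u ∷ₛ t ∷ₛ []ₛ) (induction ((x₂ ⊕ x₁) ⊕ x₀ ≐ x₂ ⊕ (x₁ ⊕ x₀))
    (≐-trans (⊕-O (x₁ ⊕ x₀)) (⊕-cong (≐I x₁) (≐-sym (⊕-O x₀))))
    (⇒I (≐-trans (⊕-s (x₂ ⊕ x₁) x₀) (≐-trans (s-cong (hyp (here refl)))
      (≐-sym (≐-trans (⊕-cong (≐I x₂) (⊕-s x₁ x₀)) (⊕-s x₂ (x₁ ⊕ x₀))))))))

  ≤-definition : (t u : Term n) → PA ∣ Γ ⊩ t ≤̇ u ⇔̇ ∃̇ (wkₜ t ⊕ x₀ ≐ wkₜ u)
  ≤-definition t u = inst (u ∷ₛ t ∷ₛ []ₛ) (∀-open (∀-open (axiom ≤-def)))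

  -- Together with `s≰O` and `s≤s-⇔` this describes the order recursively; later inductions rely on
  -- these laws instead of the witnesses in `≤-def`.
  O≤ : (t : Term n) → PA ∣ Γ ⊩ O ≤̇ t
  O≤ t = inst (t ∷ₛ []ₛ) (⇒E (∧E₂ (≤-definition O x₀)) (∃I x₀ (O-⊕ x₀)))

  s≰O : (t : Term n) → PA ∣ Γ ⊩ ¬̇ (s t ≤̇ O)
  s≰O t = inst (t ∷ₛ []ₛ) (⇒I (∃E (⇒E (∧E₁ (≤-definition (s x₀) O)) (hyp (here refl)))
    (⇒E (s≢O (x₁ ⊕ x₀)) (≐-trans (≐-sym (s-⊕ x₁ x₀)) (hyp (here refl))))))

  s≤s-⇔ : (t u : Term n) → PA ∣ Γ ⊩ s t ≤̇ s u ⇔̇ t ≤̇ u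
  s≤s-⇔ t u = inst (t ∷ₛ u ∷ₛ []ₛ) (∧I
    (⇒I (∃E (⇒E (∧E₁ (≤-definition (s x₀) (s x₁))) (hyp (here refl)))
      (⇒E (∧E₂ (≤-definition x₁ x₂)) (∃I x₀
        (s-injective (≐-trans (≐-sym (s-⊕ x₁ x₀)) (hyp (here refl))))))))
    (⇒I (∃E (⇒E (∧E₁ (≤-definition x₀ x₁)) (hyp (here refl)))
      (⇒E (∧E₂ (≤-definition (s x₁) (s x₂))) (∃I x₀
        (≐-trans (s-⊕ x₁ x₀) (s-cong (hyp (here refl)))))))))

  ≤-refl : (t : Term n) → PA ∣ Γ ⊩ t ≤̇ t
  ≤-refl t = inst (t ∷ₛ []ₛ) (induction (x₀ ≤̇ x₀) (O≤ O) (∧E₂ (s≤s-⇔ x₀ x₀)))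

  ≤O : (t : Term n) → PA ∣ Γ ⊩ t ≤̇ O ⇒ t ≐ O
  ≤O t = inst (t ∷ₛ []ₛ) (case-zero-suc (x₀ ≤̇ O ⇒ x₀ ≐ O)
    (⇒I (≐I O)) (⇒I (⊥E (⇒E (s≰O x₀) (hyp (here refl))))))

  ≤-suc : (t u : Term n) → PA ∣ Γ ⊩ t ≤̇ u ⇒ t ≤̇ s u
  ≤-suc t u = inst (t ∷ₛ u ∷ₛ []ₛ) (double-induction (x₀ ≤̇ x₁ ⇒ x₀ ≤̇ s x₁)
    (⇒I (O≤ (s O))) (⇒I (O≤ (s (s x₀)))) (⇒I (⊥E (⇒E (s≰O x₀) (hyp (here refl)))))
    (⇒I (⇒I (⇒E (∧E₂ (s≤s-⇔ x₀ (s x₁)))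
      (⇒E (hyp (there (here refl))) (⇒E (∧E₁ (s≤s-⇔ x₀ x₁)) (hyp (here refl))))))))

  ≤-suc⁻¹ : (t u : Term n) → PA ∣ Γ ⊩ t ≤̇ s u ⇒ t ≤̇ u ∨ t ≐ s u
  ≤-suc⁻¹ t u = inst (t ∷ₛ u ∷ₛ []ₛ) (double-induction (x₀ ≤̇ s x₁ ⇒ x₀ ≤̇ x₁ ∨ x₀ ≐ s x₁)
    (⇒I (∨I₁ (O≤ O))) (⇒I (∨I₁ (O≤ (s x₀))))
    (⇒I (∨I₂ (s-cong (⇒E (≤O x₀) (⇒E (∧E₁ (s≤s-⇔ x₀ O)) (hyp (here refl)))))))
    (⇒I (⇒I (∨E (⇒E (hyp (there (here refl))) (⇒E (∧E₁ (s≤s-⇔ x₀ (s x₁))) (hyp (here refl))))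
      (∨I₁ (⇒E (∧E₂ (s≤s-⇔ x₀ x₁)) (hyp (here refl))))
      (∨I₂ (s-cong (hyp (here refl))))))))

  wk-[] : (ψ : Formula (suc n)) (t : Term n) → wk (ψ [ t ]) ≡ sub (wkₜ t ∷ₛ x₊) ψ
  wk-[] ψ t = trans (ren-as-sub suc (ψ [ t ])) (trans (sub-sub (single t) x₊ ψ)
    (sub-cong (λ { zero → sym (renₜ-as-subₜ suc t) ; (suc i) → refl }) ψ))

  ≐-[] : (ψ : Formula (suc n)) (t : Term n) → U ∣ Γ ⊩ x₀ ≐ wkₜ t → U ∣ Γ ⊩ wk (ψ [ t ]) ⇒ ψ
  ≐-[] ψ t d = cast (cong₂ _⇒_ (sym (wk-[] ψ t)) (sub-≡var (λ { zero → refl ; (suc i) → refl }) ψ))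
    (sub-≐ ψ x₊ (≐-sym d))

  -- With `∀≤s` this unfolds a bounded universal quantifier by recursion on its bound, in the form
  -- needed for induction on the bound inside `S`.
  ∀≤O : (ψ : Formula (suc n)) → PA ⊢ (∀̇ (x₀ ≤̇ O ⇒ ψ)) ⇔̇ ψ [ O ]
  ∀≤O ψ = ∧I
    (⇒I (⇒E (∀E O (hyp (here refl))) (O≤ O)))
    (⇒I (∀I (⇒I (⇒E (≐-[] ψ O (⇒E (≤O x₀) (hyp (here refl)))) (hyp (there (here refl)))))))

  ∀≤s : (ψ : Formula (suc n)) (t : Term n) →
        PA ⊢ (∀̇ (x₀ ≤̇ wkₜ (s t) ⇒ ψ)) ⇔̇ ψ [ s t ] ∧ (∀̇ (x₀ ≤̇ wkₜ t ⇒ ψ))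
  ∀≤s ψ t = ∧I
    (⇒I (∧I
      (⇒E (∀E (s t) (hyp (here refl)))
          (cast (cong (s t ≤̇_) (sym (single-wkₜ (s t) (s t)))) (≤-refl (s t))))
      (∀I (⇒I (⇒E (wk-∀E (hyp (there (here refl)))) (⇒E (≤-suc x₀ (wkₜ t)) (hyp (here refl))))))))
    (⇒I (∀I (⇒I (∨E (⇒E (≤-suc⁻¹ x₀ (wkₜ t)) (hyp (here refl)))
      (⇒E (wk-∀E (∧E₂ (hyp (there (there (here refl)))))) (hyp (here refl)))
      (⇒E (≐-[] ψ (s t) (hyp (here refl))) (∧E₁ (hyp (there (there (here refl))))))))))

  numeral-⊕ : ∀ a b → PA ∣ Γ ⊩ numeral {n} a ⊕ numeral b ≐ numeral (a ℕ.+ b)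
  numeral-⊕ zero    b = O-⊕ (numeral b)
  numeral-⊕ (suc a) b = ≐-trans (s-⊕ (numeral a) (numeral b)) (s-cong (numeral-⊕ a b))

  -- The factors are swapped in the value because `*-S` recurses on the second factor and `ℕ.*` on
  -- the first.
  numeral-⊗ : ∀ a b → PA ∣ Γ ⊩ numeral {n} a ⊗ numeral b ≐ numeral (b ℕ.* a)
  numeral-⊗ a zero    = ⊗-O (numeral a)
  numeral-⊗ a (suc b) = ≐-trans (⊗-s (numeral a) (numeral b))
    (≐-trans (⊕-cong (numeral-⊗ a b) (≐I (numeral a)))
      (cast (cong (λ c → numeral (b ℕ.* a) ⊕ numeral a ≐ numeral c) (+-comm (b ℕ.* a) a))
        (numeral-⊕ (b ℕ.* a) a)))

  -- Applied to a code, this connects the closed term `⌜ φ ⌝ᵈ` of a sentence with the numeral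
  -- `⌜ φ ⌝`.
  numeral-value : (t : Term 0) (ρ : Fin 0 → ℕ) → PA ∣ Γ ⊩ t ≐ numeral (⟦ t ⟧ ρ)
  numeral-value O       ρ = ≐I O
  numeral-value (s t)   ρ = s-cong (numeral-value t ρ)
  numeral-value (t ⊕ u) ρ =
    ≐-trans (⊕-cong (numeral-value t ρ) (numeral-value u ρ)) (numeral-⊕ (⟦ t ⟧ ρ) (⟦ u ⟧ ρ))
  numeral-value (t ⊗ u) ρ =
    ≐-trans (⊗-cong (numeral-value t ρ) (numeral-value u ρ))
      (cast (cong (λ c → numeral (⟦ t ⟧ ρ) ⊗ numeral (⟦ u ⟧ ρ) ≐ numeral c) (*-comm (⟦ u ⟧ ρ) (⟦ t ⟧ ρ)))
        (numeral-⊗ (⟦ t ⟧ ρ) (⟦ u ⟧ ρ)))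

-- Codes of formulas with dotted variables

-- The terms sᵏ x and sᵏ 0: for these the code of the numeral of the value is
-- obtained by substituting into the code of the dotted variable.
data Simple {n : ℕ} : Term n → Set where
  var : ∀ i → Simple (var i)
  O   : Simple O
  s   : ∀ {t} → Simple t → Simple (s t)

module _ (θ : Sub m n) (simple : ∀ i → Simple (θ i)) where

  lifts : ∀ k → Sub (k ℕ.+ m) (k ℕ.+ n)
  lifts zero    = θ
  lifts (suc k) = lift (lifts k)

  -- Below `k` binders a bound variable stays itself and a dotted one carries its value under `θ`,
  -- shifted past the binders. This matches the case distinction by `splitAt` in the definition of
  -- the codes.
  lifts-split : ∀ k i → lifts k i ≡ [ (λ b → var (b ↑ˡ n)) , (λ j → renₜ (k ↑ʳ_) (θ j)) ]′ (splitAt k i)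
  lifts-split zero    i       = sym (trans (renₜ-as-subₜ id (θ i)) (subₜ-var (θ i)))
  lifts-split (suc k) zero    = refl
  lifts-split (suc k) (suc i) rewrite lifts-split k i with splitAt k i
  ... | inj₁ b = refl
  ... | inj₂ j = trans (renₜ-as-subₜ suc (renₜ (k ↑ʳ_) (θ j)))
                   (trans (subₜ-renₜ (k ↑ʳ_) x₊ (θ j)) (sym (renₜ-as-subₜ (suc k ↑ʳ_) (θ j))))

  subₜ-numeral : ∀ j → subₜ θ (numeral j) ≡ numeral j
  subₜ-numeral zero    = refl
  subₜ-numeral (suc j) = cong s (subₜ-numeral j)

  -- The numeral of the value of a simple `t` consists of successors around `O`. Hence the number of
  -- successors is `t` itself, while the head tag and head arguments, treated next, are those of
  -- `O`.
  successorsᵈ-simple : ∀ k {t : Term n} → Simple t → successorsᵈ k (renₜ (k ↑ʳ_) t) ≡ t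
  successorsᵈ-simple k (var i) rewrite splitAt-↑ʳ k n i = refl
  successorsᵈ-simple k O       = refl
  successorsᵈ-simple k (s p)   = cong s (successorsᵈ-simple k p)

  headTagᵈ-simple : ∀ k {t : Term n} → Simple t → headTagᵈ k (renₜ (k ↑ʳ_) t) ≡ O
  headTagᵈ-simple k (var i) rewrite splitAt-↑ʳ k n i = refl
  headTagᵈ-simple k O       = refl
  headTagᵈ-simple k (s p)   = headTagᵈ-simple k p

  headArgsᵈ-simple : ∀ k {t : Term n} → Simple t → headArgsᵈ k (renₜ (k ↑ʳ_) t) ≡ O
  headArgsᵈ-simple k (var i) rewrite splitAt-↑ʳ k n i = refl
  headArgsᵈ-simple k O       = refl
  headArgsᵈ-simple k (s p)   = headArgsᵈ-simple k p

  successorsᵈ-sub : ∀ k t → successorsᵈ k (subₜ (lifts k) t) ≡ subₜ θ (successorsᵈ k t)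
  successorsᵈ-sub k (var i) rewrite lifts-split k i with splitAt k i
  ... | inj₁ b rewrite splitAt-↑ˡ k b n = refl
  ... | inj₂ j = successorsᵈ-simple k (simple j)
  successorsᵈ-sub k O       = refl
  successorsᵈ-sub k (s t)   = cong s (successorsᵈ-sub k t)
  successorsᵈ-sub k (t ⊕ u) = refl
  successorsᵈ-sub k (t ⊗ u) = refl

  headTagᵈ-sub : ∀ k t → headTagᵈ k (subₜ (lifts k) t) ≡ subₜ θ (headTagᵈ k t)
  headTagᵈ-sub k (var i) rewrite lifts-split k i with splitAt k i
  ... | inj₁ b rewrite splitAt-↑ˡ k b n = refl
  ... | inj₂ j = headTagᵈ-simple k (simple j)
  headTagᵈ-sub k O       = refl
  headTagᵈ-sub k (s t)   = headTagᵈ-sub k t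
  headTagᵈ-sub k (t ⊕ u) = refl
  headTagᵈ-sub k (t ⊗ u) = refl

  mutual
    gnₜᵈ-sub : ∀ k t → gnₜᵈ k (subₜ (lifts k) t) ≡ subₜ θ (gnₜᵈ k t)
    gnₜᵈ-sub k t = cong₂ pairᵈ (successorsᵈ-sub k t)
                     (cong₂ pairᵈ (headTagᵈ-sub k t) (headArgsᵈ-sub k t))

    headArgsᵈ-sub : ∀ k t → headArgsᵈ k (subₜ (lifts k) t) ≡ subₜ θ (headArgsᵈ k t)
    headArgsᵈ-sub k (var i) rewrite lifts-split k i with splitAt k i
    ... | inj₁ b rewrite splitAt-↑ˡ k b n = sym (subₜ-numeral (toℕ b))
    ... | inj₂ j = headArgsᵈ-simple k (simple j)
    headArgsᵈ-sub k O       = refl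
    headArgsᵈ-sub k (s t)   = headArgsᵈ-sub k t
    headArgsᵈ-sub k (t ⊕ u) = cong₂ pairᵈ (gnₜᵈ-sub k t) (gnₜᵈ-sub k u)
    headArgsᵈ-sub k (t ⊗ u) = cong₂ pairᵈ (gnₜᵈ-sub k t) (gnₜᵈ-sub k u)

  mutual
    gnᵈ-sub : ∀ k φ → gnᵈ k (sub (lifts k) φ) ≡ subₜ θ (gnᵈ k φ)
    gnᵈ-sub k φ = cong₂ pairᵈ
      (trans (cong numeral (tag-sub φ)) (sym (subₜ-numeral (tag φ)))) (argsᵈ-sub k φ)
      where
      tag-sub : ∀ ψ → tag (sub (lifts k) ψ) ≡ tag ψ
      tag-sub ⊥̇       = refl
      tag-sub (_ ≐ _) = refl
      tag-sub (_ ≤̇ _) = refl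
      tag-sub (_ ⇒ _) = refl
      tag-sub (_ ∧ _) = refl
      tag-sub (_ ∨ _) = refl
      tag-sub (∀̇ _)   = refl
      tag-sub (∃̇ _)   = refl

    argsᵈ-sub : ∀ k φ → argsᵈ k (sub (lifts k) φ) ≡ subₜ θ (argsᵈ k φ)
    argsᵈ-sub k ⊥̇       = refl
    argsᵈ-sub k (t ≐ u) = cong₂ pairᵈ (gnₜᵈ-sub k t) (gnₜᵈ-sub k u)
    argsᵈ-sub k (t ≤̇ u) = cong₂ pairᵈ (gnₜᵈ-sub k t) (gnₜᵈ-sub k u)
    argsᵈ-sub k (φ ⇒ ψ) = cong₂ pairᵈ (gnᵈ-sub k φ) (gnᵈ-sub k ψ)
    argsᵈ-sub k (φ ∧ ψ) = cong₂ pairᵈ (gnᵈ-sub k φ) (gnᵈ-sub k ψ)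
    argsᵈ-sub k (φ ∨ ψ) = cong₂ pairᵈ (gnᵈ-sub k φ) (gnᵈ-sub k ψ)
    argsᵈ-sub k (∀̇ φ)   = gnᵈ-sub (suc k) φ
    argsᵈ-sub k (∃̇ φ)   = gnᵈ-sub (suc k) φ

  -- For simple values the two codes are the same term. For a value such as `x₀ ⊕ x₁` they differ:
  -- the left side would code a sum and the right side the numeral of its value.
  ⌜⌝ᵈ-sub : ∀ φ → ⌜ sub θ φ ⌝ᵈ ≡ subₜ θ ⌜ φ ⌝ᵈ
  ⌜⌝ᵈ-sub = gnᵈ-sub 0

-- Provability predicates

ITE : Formula n → Formula n → Formula n → Formula n
ITE φ A B = (φ ∧ A) ∨ (¬̇ φ ∧ B)

iteₛ : Schema k → Schema k → Schema k → Schema k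
iteₛ a b c = (a & b) ∥ ((a ⟶ ff) & c)

module Provability
  (S T : Theory) (S⊇PA : S Extends PA) (T⊇PA : T Extends PA) (Pr : Formula 1)
  (provability : IsProvabilityPredicate S T Pr) (eᵁ : Eᵁ S T Pr) (cb∃ : CB∃ S Pr) where

  open Peano using (⊕-O; ⊕-s; ⊗-O; ⊗-s; O-⊕; s-⊕; ⊕-assoc; s≢O; s-injective;
                    O≤; s≰O; s≤s-⇔; ∀≤O; ∀≤s; numeral-value)
  open Induction S⊇PA

  -- Opaque, so that unification compares arguments of P instead of unfolding codes.
  opaque

    P : Formula n → Formula n
    P φ = Pr ⟨ ⌜ φ ⌝ᵈ ⟩

    P-unfold : (φ : Formula n) → P φ ≡ Pr ⟨ ⌜ φ ⌝ᵈ ⟩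
    P-unfold φ = refl

    P-⇔ : {φ ψ : Formula n} → PA ⊢ φ ⇔̇ ψ → S ⊢ P φ ⇔̇ P ψ
    P-⇔ {φ = φ} {ψ} d = ∀*E (eᵁ φ ψ (∀*I (T⊇PA _ d)))

    P-sub : (θ : Sub m n) → (∀ i → Simple (θ i)) → ∀ χ → P (sub θ χ) ≡ sub θ (P χ)
    P-sub θ simple χ =
      trans (sub-cong (λ _ → ⌜⌝ᵈ-sub θ simple χ) Pr) (sym (sub-sub (λ _ → ⌜ χ ⌝ᵈ) θ Pr))

  -- Substitutions that commute with the provability predicate

  -- On the left the values of σ occur as terms inside the code; on the right the code
  -- contains the numerals of these values.
  Commute : Sub m n → Formula m → Formula n
  Commute σ χ = P (sub σ χ) ⇔̇ sub σ (P χ)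

  Transparent : Sub m n → Set
  Transparent σ = ∀ χ → S ⊢ Commute σ χ

  transparent-cong : {σ τ : Sub m n} → (∀ i → σ i ≡ τ i) → Transparent σ → Transparent τ
  transparent-cong e g χ = cast (cong₂ _⇔̇_ (cong P (sub-cong e χ)) (sub-cong e (P χ))) (g χ)

  simple⇒transparent : (θ : Sub m n) → (∀ i → Simple (θ i)) → Transparent θ
  simple⇒transparent θ simple χ = cast (cong (P (sub θ χ) ⇔̇_) (P-sub θ simple χ)) ⇔-refl

  -- Transparency of `τ` at `sub σ χ` moves `τ` into the code; the rest is composition of
  -- substitutions. This gives the instances needed when `Commute σ χ` is the induction formula.
  sub-Commute : (σ : Sub l m) (τ : Sub m n) → Transparent τ → ∀ χ →
                S ⊢ sub τ (Commute σ χ) ⇔̇ Commute (subₜ τ ∘ σ) χ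
  sub-Commute σ τ g χ =
    cast (cong (λ ψ → sub τ (Commute σ χ) ⇔̇ (P (sub (subₜ τ ∘ σ) χ) ⇔̇ ψ)) (sub-sub σ τ (P χ)))
      (⇒E (taut ((a₀ ⟷ a₁) ⟶ ((a₁ ⟷ a₂) ⟷ (a₀ ⟷ a₂)))
             (P (sub (subₜ τ ∘ σ) χ) ∷ sub τ (P (sub σ χ)) ∷ sub τ (sub σ (P χ)) ∷ []) refl)
        (cast (cong (λ ψ → P ψ ⇔̇ sub τ (P (sub σ χ))) (sub-sub σ τ χ)) (g (sub σ χ))))

  transparent-∘ : (σ : Sub l m) (τ : Sub m n) → Transparent σ → Transparent τ →
                  Transparent (subₜ τ ∘ σ)
  transparent-∘ σ τ f g χ = ⇒E (∧E₁ (sub-Commute σ τ g χ)) (inst τ (f χ))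

  -- The equality acts on the two sides for different reasons: within the code through `P-⇔`,
  -- outside it by replacement in `S`.
  Commute-≐ : (σ : Sub m n) {t u : Term n} → PA ⊢ t ≐ u → ∀ χ →
              S ⊢ Commute (u ∷ₛ σ) χ ⇒ Commute (t ∷ₛ σ) χ
  Commute-≐ σ {t} {u} d χ =
    ⇒E (⇒E (taut ((a₀ ⟷ a₁) ⟶ (a₂ ⟷ a₃) ⟶ (a₁ ⟷ a₃) ⟶ (a₀ ⟷ a₂))
              (P (sub (t ∷ₛ σ) χ) ∷ P (sub (u ∷ₛ σ) χ) ∷ sub (t ∷ₛ σ) (P χ) ∷ sub (u ∷ₛ σ) (P χ) ∷ []) refl)
         (P-⇔ (sub-≐⇔ χ σ d)))
       (S⊇PA _ (sub-≐⇔ (P χ) σ d))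

  transparent-≐ : (σ : Sub m n) {t u : Term n} → PA ⊢ t ≐ u →
                  Transparent (u ∷ₛ σ) → Transparent (t ∷ₛ σ)
  transparent-≐ σ d g χ = ⇒E (Commute-≐ σ d χ) (g χ)

  -- Induction on x₁; the induction hypothesis is used with t for x₀.
  transparent-induction : (w t : Term (2 ℕ.+ n)) (ρ : Ren m n) →
    Transparent (t ∷ₛ x₁ ∷ₛ x₊₊) → Transparent (subₜ (x₀ ∷ₛ O ∷ₛ x₊) w ∷ₛ (x₊ ∘ ρ)) →
    PA ⊢ subₜ (x₀ ∷ₛ s x₁ ∷ₛ x₊₊) w ≐ subₜ (t ∷ₛ x₁ ∷ₛ x₊₊) w → Transparent (w ∷ₛ (x₊₊ ∘ ρ))
  transparent-induction {n} {m} w t ρ g z d χ = induction∀ (Commute α χ)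
    (⇒E (∧E₂ (sub-Commute α _ (simple⇒transparent _
      λ { zero → var _ ; (suc zero) → O ; (suc (suc i)) → var _ }) χ)) (transparent-cong (e _) z χ))
    -- From the inside out: the hypothesis is taken at `t`, `g` moves this instance into the code,
    -- `d` replaces the value of `w`, and the simple substitution of `s x₁` for `x₁` is moved out
    -- again.
    (⇒I (⇒E (∧E₂ (thm (sub-Commute α _ (simple⇒transparent _
      λ { zero → var _ ; (suc zero) → s (var _) ; (suc (suc i)) → var _ }) χ)))
      (⇒E (thm step-Commute)
        (⇒E (∧E₁ (thm (sub-Commute α _ g χ))) (∀-inst (Commute α χ) t (hyp (here refl)))))))
    where
    α : Sub (suc m) (2 ℕ.+ n)
    α = w ∷ₛ (x₊₊ ∘ ρ)
    e : ∀ {l} (τ : Sub (2 ℕ.+ n) l) i → (subₜ τ w ∷ₛ λ j → τ (suc (suc (ρ j)))) i ≡ subₜ τ (α i)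
    e τ zero    = refl
    e τ (suc i) = refl
    Commute-cong : ∀ {k l} {σ τ : Sub k l} → (∀ i → σ i ≡ τ i) → ∀ φ → Commute σ φ ≡ Commute τ φ
    Commute-cong p φ = cong₂ _⇔̇_ (cong P (sub-cong p φ)) (sub-cong p (P φ))
    step-Commute : S ⊢ Commute (subₜ (t ∷ₛ x₁ ∷ₛ x₊₊) ∘ α) χ ⇒ Commute (subₜ (x₀ ∷ₛ s x₁ ∷ₛ x₊₊) ∘ α) χ
    step-Commute = cast (cong₂ _⇒_ (Commute-cong (e _) χ) (Commute-cong (e _) χ))
                     (Commute-≐ (x₊₊ ∘ ρ) d χ)

  x₊-transparent : Transparent {suc n} {suc n} (x₀ ∷ₛ x₊)
  x₊-transparent = simple⇒transparent _ λ { zero → var _ ; (suc i) → var _ }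

  ⊕-transparent : Transparent {suc n} (x₀ ⊕ x₁ ∷ₛ x₊₊)
  ⊕-transparent = transparent-induction (x₀ ⊕ x₁) (s x₀) id
    (simple⇒transparent _ λ { zero → s (var _) ; (suc zero) → var _ ; (suc (suc i)) → var _ })
    (transparent-≐ x₊ (⊕-O x₀) x₊-transparent)
    (≐-trans (⊕-s x₀ x₁) (≐-sym (s-⊕ x₀ x₁)))

  -- The summand `x₀` is an accumulator: the summand produced by `⊗-s` is absorbed by changing `x₀`
  -- to `x₂ ⊕ x₀`, a substitution already covered by `⊕-transparent`. The renaming `suc` keeps the
  -- parameter `x₂` out of the remaining values.
  ⊗-⊕-transparent : Transparent {suc n} (x₂ ⊗ x₁ ⊕ x₀ ∷ₛ (x₊₊ ∘ suc))
  ⊗-⊕-transparent = transparent-induction (x₂ ⊗ x₁ ⊕ x₀) (x₂ ⊕ x₀) suc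
    (transparent-cong (λ { zero → refl ; (suc zero) → refl ; (suc (suc i)) → refl })
      (transparent-∘ (x₀ ⊕ x₁ ∷ₛ x₊₊) (x₂ ∷ₛ x₀ ∷ₛ x₁ ∷ₛ x₊₊) ⊕-transparent
        (simple⇒transparent _ λ { zero → var _ ; (suc zero) → var _
                                ; (suc (suc zero)) → var _ ; (suc (suc (suc i))) → var _ })))
    (transparent-≐ (x₊ ∘ suc) (≐-trans (⊕-cong (⊗-O x₁) (≐I x₀)) (O-⊕ x₀))
      (simple⇒transparent _ λ { zero → var _ ; (suc i) → var _ }))
    (≐-trans (⊕-cong (⊗-s x₂ x₁) (≐I x₀)) (⊕-assoc (x₂ ⊗ x₁) x₂ x₀))

  ⊗-transparent : Transparent {suc n} (x₀ ⊗ x₁ ∷ₛ x₊₊)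
  ⊗-transparent = transparent-≐ x₊₊ (≐-sym (⊕-O (x₀ ⊗ x₁)))
    (transparent-cong (λ { zero → refl ; (suc i) → refl })
      -- The accumulator starts at `O`, and the factors are renamed to `x₀` and `x₁`.
      (transparent-∘ (x₂ ⊗ x₁ ⊕ x₀ ∷ₛ (x₊₊ ∘ suc)) (O ∷ₛ x₁ ∷ₛ x₀ ∷ₛ x₊₊) ⊗-⊕-transparent
        (simple⇒transparent _ λ { zero → O ; (suc zero) → var _
                                ; (suc (suc zero)) → var _ ; (suc (suc (suc i))) → var _ })))

  -- The renaming `ρ` keeps the recursion structural. Two terms are substituted one after the other,
  -- so the first must be read in a scope with one more variable; `suc ∘ ρ` records this while `t`
  -- remains a subterm.
  single-transparent : (t : Term m) (ρ : Ren m n) → Transparent (single (renₜ ρ t))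
  pair-transparent : (t u : Term m) (ρ : Ren m n) → Transparent (renₜ ρ t ∷ₛ renₜ ρ u ∷ₛ var)

  single-transparent (var i) ρ =
    simple⇒transparent _ λ { zero → var _ ; (suc j) → var _ }
  single-transparent O ρ =
    simple⇒transparent _ λ { zero → O ; (suc j) → var _ }
  single-transparent (s t) ρ =
    transparent-cong (λ { zero → refl ; (suc j) → refl })
      (transparent-∘ (s x₀ ∷ₛ x₊) (single (renₜ ρ t))
        (simple⇒transparent _ λ { zero → s (var _) ; (suc j) → var _ }) (single-transparent t ρ))
  single-transparent (t ⊕ u) ρ =
    transparent-cong (λ { zero → refl ; (suc j) → refl })
      (transparent-∘ (x₀ ⊕ x₁ ∷ₛ x₊₊) _ ⊕-transparent (pair-transparent t u ρ))
  single-transparent (t ⊗ u) ρ =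
    transparent-cong (λ { zero → refl ; (suc j) → refl })
      (transparent-∘ (x₀ ⊗ x₁ ∷ₛ x₊₊) _ ⊗-transparent (pair-transparent t u ρ))

  pair-transparent t u ρ =
    transparent-cong
      (λ { zero → trans (subₜ-renₜ (suc ∘ ρ) (single (renₜ ρ u)) t) (sym (renₜ-as-subₜ ρ t))
         ; (suc zero) → refl ; (suc (suc j)) → refl })
      (transparent-∘ (single (renₜ (suc ∘ ρ) t)) (single (renₜ ρ u))
        (single-transparent t (suc ∘ ρ)) (single-transparent u ρ))

  renₜ-id : (t : Term n) → renₜ id t ≡ t
  renₜ-id t = trans (renₜ-as-subₜ id t) (subₜ-var t)

  -- Conditionals under the provability predicate: propositional connectives

  Branch : Formula n → Formula n → Formula n → Formula n
  Branch φ A B = P (ITE φ A B) ⇔̇ ITE φ (P A) (P B)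

  Decided : Formula n → Set
  Decided φ = ∀ A B → S ⊢ Branch φ A B

  Branch-⇔ : {φ ψ : Formula n} → PA ⊢ φ ⇔̇ ψ → ∀ A B → S ⊢ Branch ψ A B ⇒ Branch φ A B
  Branch-⇔ {φ = φ} {ψ} d A B =
    ⇒E (⇒E (taut ((a₀ ⟷ a₁) ⟶ (a₂ ⟷ a₃) ⟶ (a₁ ⟷ iteₛ a₃ a₄ a₅) ⟶ (a₀ ⟷ iteₛ a₂ a₄ a₅))
              (P (ITE φ A B) ∷ P (ITE ψ A B) ∷ φ ∷ ψ ∷ P A ∷ P B ∷ []) refl)
         (P-⇔ (⇒E (taut ((a₀ ⟷ a₁) ⟶ (iteₛ a₀ a₂ a₃ ⟷ iteₛ a₁ a₂ a₃)) (φ ∷ ψ ∷ A ∷ B ∷ []) refl) d)))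
       (S⊇PA _ d)

  decided-⇔ : {φ ψ : Formula n} → PA ⊢ φ ⇔̇ ψ → Decided ψ → Decided φ
  decided-⇔ d h A B = ⇒E (Branch-⇔ d A B) (h A B)

  decided-true : {φ : Formula n} → PA ⊢ φ → Decided φ
  decided-true {φ = φ} d A B =
    ⇒E (⇒E (taut ((a₀ ⟷ a₁) ⟶ a₂ ⟶ (a₀ ⟷ iteₛ a₂ a₁ a₃)) (P (ITE φ A B) ∷ P A ∷ φ ∷ P B ∷ []) refl)
         (P-⇔ (⇒E (taut (a₀ ⟶ (iteₛ a₀ a₁ a₂ ⟷ a₁)) (φ ∷ A ∷ B ∷ []) refl) d)))
       (S⊇PA _ d)

  decided-false : {φ : Formula n} → PA ⊢ ¬̇ φ → Decided φ
  decided-false {φ = φ} d A B =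
    ⇒E (⇒E (taut ((a₀ ⟷ a₁) ⟶ (a₂ ⟶ ff) ⟶ (a₀ ⟷ iteₛ a₂ a₃ a₁)) (P (ITE φ A B) ∷ P B ∷ φ ∷ P A ∷ []) refl)
         (P-⇔ (⇒E (taut ((a₀ ⟶ ff) ⟶ (iteₛ a₀ a₁ a₂ ⟷ a₂)) (φ ∷ A ∷ B ∷ []) refl) d)))
       (S⊇PA _ d)

  decided-⊥ : Decided {n} ⊥̇
  decided-⊥ = decided-false (⇒I (hyp (here refl)))

  decided-⇒ : {φ ψ : Formula n} → Decided φ → Decided ψ → Decided (φ ⇒ ψ)
  decided-⇒ {φ = φ} {ψ} f g A B =
    ⇒E (⇒E (⇒E (taut ((a₀ ⟷ a₁) ⟶ (a₁ ⟷ iteₛ a₃ a₂ a₅) ⟶ (a₂ ⟷ iteₛ a₄ a₅ a₆) ⟶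
                        (a₀ ⟷ iteₛ (a₃ ⟶ a₄) a₅ a₆))
                  (P (ITE (φ ⇒ ψ) A B) ∷ P (ITE φ (ITE ψ A B) A) ∷ P (ITE ψ A B) ∷
                    φ ∷ ψ ∷ P A ∷ P B ∷ []) refl)
             (P-⇔ (taut (iteₛ (a₀ ⟶ a₁) a₂ a₃ ⟷ iteₛ a₀ (iteₛ a₁ a₂ a₃) a₂) (φ ∷ ψ ∷ A ∷ B ∷ []) refl)))
           (f (ITE ψ A B) A))
       (g A B)

  decided-¬ : {φ : Formula n} → Decided φ → Decided (¬̇ φ)
  decided-¬ f = decided-⇒ f decided-⊥

  decided-∧ : {φ ψ : Formula n} → Decided φ → Decided ψ → Decided (φ ∧ ψ)
  decided-∧ {φ = φ} {ψ} f g =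
    decided-⇔ (taut ((a₀ & a₁) ⟷ ((a₀ ⟶ a₁ ⟶ ff) ⟶ ff)) (φ ∷ ψ ∷ []) refl)
      (decided-¬ (decided-⇒ f (decided-¬ g)))

  decided-∨ : {φ ψ : Formula n} → Decided φ → Decided ψ → Decided (φ ∨ ψ)
  decided-∨ {φ = φ} {ψ} f g =
    decided-⇔ (taut ((a₀ ∥ a₁) ⟷ ((a₀ ⟶ ff) ⟶ a₁)) (φ ∷ ψ ∷ []) refl)
      (decided-⇒ (decided-¬ f) g)

  -- Atomic formulas

  -- Transparency is used once for each of the three occurrences of `P`; the condition `φ` outside
  -- the codes is substituted directly.
  sub-Branch : (τ : Sub m n) → Transparent τ → ∀ φ A B →
               S ⊢ sub τ (Branch φ A B) ⇔̇ Branch (sub τ φ) (sub τ A) (sub τ B)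
  sub-Branch τ g φ A B =
    ⇒E (⇒E (⇒E (taut ((a₀ ⟷ a₁) ⟶ (a₂ ⟷ a₃) ⟶ (a₄ ⟷ a₅) ⟶
                        ((a₁ ⟷ iteₛ a₆ a₃ a₅) ⟷ (a₀ ⟷ iteₛ a₆ a₂ a₄)))
                  (P (sub τ (ITE φ A B)) ∷ sub τ (P (ITE φ A B)) ∷ P (sub τ A) ∷ sub τ (P A) ∷
                    P (sub τ B) ∷ sub τ (P B) ∷ sub τ φ ∷ []) refl)
             (g (ITE φ A B)))
           (g A))
       (g B)

  Branch-cong : {φ φ′ A A′ B B′ : Formula n} → φ ≡ φ′ → A ≡ A′ → B ≡ B′ →
                Branch φ A B ≡ Branch φ′ A′ B′
  Branch-cong refl refl refl = refl

  -- The premises say that `r` is settled when an argument is zero and is unchanged when both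
  -- arguments lose a successor. The double induction runs on two fresh variables, with `A` and `B`
  -- shifted past them; `pair-transparent` then brings in `t` and `u`.
  decided-relation : (r : ∀ {n} → Term n → Term n → Formula n) →
    (∀ {m n} (σ : Sub m n) t u → sub σ (r t u) ≡ r (subₜ σ t) (subₜ σ u)) →
    (∀ {n} → Decided {n} (r O O)) →
    (∀ {n} (t : Term n) → Decided (r O (s t))) →
    (∀ {n} (t : Term n) → Decided (r (s t) O)) →
    (∀ {n} (t u : Term n) → PA ⊢ r (s t) (s u) ⇔̇ r t u) →
    (t u : Term n) → Decided (r t u)
  decided-relation {n} r nat z₀₀ z₀₁ z₁₀ d t u A B =
    cast (Branch-cong (trans (nat τ x₀ x₁) (cong₂ r (renₜ-id t) (renₜ-id u))) (drop A) (drop B))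
      (⇒E (∧E₁ (sub-Branch τ (pair-transparent t u id) (r x₀ x₁) (sub x₊₊ A) (sub x₊₊ B)))
        (inst τ (double-induction (Branch (r x₀ x₁) (sub x₊₊ A) (sub x₊₊ B))
          (base _ z₀₀ (λ { zero → O ; (suc zero) → O ; (suc (suc i)) → var _ }))
          (base _ (z₀₁ x₀) (λ { zero → O ; (suc zero) → s (var _) ; (suc (suc i)) → var _ }))
          (base _ (z₁₀ x₀) (λ { zero → s (var _) ; (suc zero) → O ; (suc (suc i)) → var _ }))
          (⇒I (⇒E (∧E₂ (thm (sub-Branch _ (simple⇒transparent _
              (λ { zero → s (var _) ; (suc zero) → s (var _) ; (suc (suc i)) → var _ }))
              (r x₀ x₁) (sub x₊₊ A) (sub x₊₊ B))))
            (cast (Branch-cong (sym (nat _ x₀ x₁)) (sym (sub-sub x₊₊ _ A)) (sym (sub-sub x₊₊ _ B)))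
              (⇒E (thm (Branch-⇔ (d x₀ x₁) (sub x₊₊ A) (sub x₊₊ B))) (hyp (here refl)))))))))
    where
    τ : Sub (2 ℕ.+ n) n
    τ = renₜ id t ∷ₛ renₜ id u ∷ₛ var
    drop : ∀ φ → sub τ (sub x₊₊ φ) ≡ φ
    drop φ = trans (sub-sub x₊₊ τ φ) (sub-var φ)
    base : (σ : Sub (2 ℕ.+ n) m) → Decided (r (σ zero) (σ (suc zero))) → (∀ i → Simple (σ i)) →
           S ⊢ sub σ (Branch (r x₀ x₁) (sub x₊₊ A) (sub x₊₊ B))
    base σ h simple =
      ⇒E (∧E₂ (sub-Branch σ (simple⇒transparent σ simple) (r x₀ x₁) (sub x₊₊ A) (sub x₊₊ B)))
         (subst Decided (sym (nat σ x₀ x₁)) h (sub σ (sub x₊₊ A)) (sub σ (sub x₊₊ B)))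

  decided-≐ : (t u : Term n) → Decided (t ≐ u)
  decided-≐ = decided-relation _≐_ (λ _ _ _ → refl) (decided-true (≐I O))
    (λ t → decided-false (⇒I (⇒E (s≢O t) (≐-sym (hyp (here refl))))))
    (λ t → decided-false (s≢O t))
    (λ t u → ∧I (⇒I (s-injective (hyp (here refl)))) (⇒I (s-cong (hyp (here refl)))))

  decided-≤̇ : (t u : Term n) → Decided (t ≤̇ u)
  decided-≤̇ = decided-relation _≤̇_ (λ _ _ _ → refl) (decided-true (O≤ O))
    (λ t → decided-true (O≤ (s t))) (λ t → decided-false (s≰O t)) s≤s-⇔

  -- Bounded quantifiers

  -- Branch fixes the scope of its branches, so Decided is not visibly closed under substitution.
  Stable : Formula n → Set
  Stable {n} ψ = ∀ {m} (θ : Sub n m) → Decided (sub θ ψ)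

  stable-sub : (σ : Sub m n) {ψ : Formula m} → Stable ψ → Stable (sub σ ψ)
  stable-sub σ {ψ} h θ = subst Decided (sym (sub-sub σ θ ψ)) (h (subₜ θ ∘ σ))

  -- ITE (∀z≤st ψ) A B is equivalent to ITE ψ(st) (ITE (∀z≤t ψ) A B) B.
  Branch-∀≤s : (ψ : Formula (suc n)) (t : Term n) → Decided (ψ [ s t ]) → ∀ A B →
    S ⊢ Branch (∀̇ (x₀ ≤̇ wkₜ t ⇒ ψ)) A B ⇒ Branch (∀̇ (x₀ ≤̇ wkₜ (s t) ⇒ ψ)) A B
  Branch-∀≤s ψ t h A B =
    ⇒E (⇒E (⇒E (taut ((a₀ ⟷ a₁) ⟶ (a₁ ⟷ iteₛ a₃ a₂ a₆) ⟶ (a₇ ⟷ (a₃ & a₄)) ⟶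
                        (a₂ ⟷ iteₛ a₄ a₅ a₆) ⟶ (a₀ ⟷ iteₛ a₇ a₅ a₆))
                  (P (ITE β′ A B) ∷ P (ITE (ψ [ s t ]) (ITE β A B) B) ∷ P (ITE β A B) ∷
                    ψ [ s t ] ∷ β ∷ P A ∷ P B ∷ β′ ∷ []) refl)
             (P-⇔ (⇒E (taut ((a₀ ⟷ (a₁ & a₂)) ⟶ (iteₛ a₀ a₃ a₄ ⟷ iteₛ a₁ (iteₛ a₂ a₃ a₄) a₄))
                        (β′ ∷ ψ [ s t ] ∷ β ∷ A ∷ B ∷ []) refl) (∀≤s ψ t))))
           (h (ITE β A B) B))
       (S⊇PA _ (∀≤s ψ t))
    where
    β  = ∀̇ (x₀ ≤̇ wkₜ t ⇒ ψ)
    β′ = ∀̇ (x₀ ≤̇ wkₜ (s t) ⇒ ψ)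

  -- The bound is replaced by a fresh variable for the induction in `S`, and `single-transparent`
  -- puts `t` back at the end. Stability supplies the instances of `ψ` at `O` in the base case and
  -- at `s x₀` in the step.
  decided-∀≤ : {ψ : Formula (suc n)} → Stable ψ → ∀ t → Decided (∀̇ (x₀ ≤̇ wkₜ t ⇒ ψ))
  decided-∀≤ {n} {ψ} h t A B =
    cast (Branch-cong (cong₂ (λ u χ → ∀̇ (x₀ ≤̇ wkₜ u ⇒ χ)) (renₜ-id t) (drop-lift (single (renₜ id t)) (λ _ → refl)))
           (drop A) (drop B))
      (⇒E (∧E₁ (sub-Branch (single (renₜ id t)) (single-transparent t id) β A↑ B↑))
        (inst (single (renₜ id t)) (induction (Branch β A↑ B↑) base step-β)))
    where
    ψ↑ : Formula (2 ℕ.+ n)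
    ψ↑ = sub (lift x₊) ψ
    β : Formula (suc n)
    β = ∀̇ (x₀ ≤̇ x₁ ⇒ ψ↑)
    A↑ = sub x₊ A
    B↑ = sub x₊ B
    drop : ∀ φ → sub (single (renₜ id t)) (sub x₊ φ) ≡ φ
    drop φ = trans (sub-sub x₊ _ φ) (sub-var φ)
    drop-lift : (τ : Sub (suc n) n) → (∀ i → τ (suc i) ≡ var i) → sub (lift τ) ψ↑ ≡ ψ
    drop-lift τ e = trans (sub-sub (lift x₊) (lift τ) ψ)
      (sub-≡var (λ { zero → refl ; (suc i) → cong wkₜ (e i) }) ψ)
    base : S ⊢ sub (O ∷ₛ var) (Branch β A↑ B↑)
    base = ⇒E (∧E₂ (sub-Branch (O ∷ₛ var)
        (simple⇒transparent _ λ { zero → O ; (suc i) → var _ }) β A↑ B↑))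
      (decided-⇔ (∀≤O (sub (lift (O ∷ₛ var)) ψ↑))
        (stable-sub (lift (O ∷ₛ var)) (stable-sub (lift x₊) h) (single O)) _ _)
    step-β : S ⊢ Branch β A↑ B↑ ⇒ sub (s x₀ ∷ₛ x₊) (Branch β A↑ B↑)
    step-β = ⇒I (⇒E (∧E₂ (thm (sub-Branch (s x₀ ∷ₛ x₊)
        (simple⇒transparent _ λ { zero → s (var _) ; (suc i) → var _ }) β A↑ B↑)))
      (cast (Branch-cong
          (cong (λ χ → ∀̇ (x₀ ≤̇ s x₁ ⇒ χ)) (sym (trans (sub-sub (lift x₊) _ ψ)
            (sub-cong (λ { zero → refl ; (suc i) → refl }) ψ))))
          (sym (sub-sub x₊ _ A)) (sym (sub-sub x₊ _ B)))
        (⇒E (thm (Branch-∀≤s ψ↑ x₀ (stable-sub (lift x₊) h (single (s x₀))) A↑ B↑)) (hyp (here refl)))))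

  ∃≤-as-∀≤ : (t : Term (suc n)) (ψ : Formula (suc n)) →
             PA ⊢ (∃̇ (x₀ ≤̇ t ∧ ψ)) ⇔̇ ¬̇ (∀̇ (x₀ ≤̇ t ⇒ ¬̇ ψ))
  ∃≤-as-∀≤ t ψ = ∧I
    (⇒I (⇒I (∃E (hyp (there (here refl)))
      (⇒E (⇒E (wk-∀E (hyp (there (here refl)))) (∧E₁ (hyp (here refl)))) (∧E₂ (hyp (here refl)))))))
    (⇒I (raa (⇒E (hyp (there (here refl))) (∀I (⇒I (⇒I
      (⇒E (hyp (there (there (here refl)))) (∃I x₀ (cast (sym e)
        (∧I (hyp (there (here refl))) (hyp (here refl))))))))))))
    where
    e : ren (liftᵣ suc) (x₀ ≤̇ t ∧ ψ) [ x₀ ] ≡ (x₀ ≤̇ t ∧ ψ)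
    e = trans (sub-ren (liftᵣ suc) (single x₀) (x₀ ≤̇ t ∧ ψ))
              (sub-≡var (λ { zero → refl ; (suc i) → refl }) (x₀ ≤̇ t ∧ ψ))

  Δ₀⇒stable : {φ : Formula n} → Δ₀ φ → Stable φ
  Δ₀⇒stable bot       θ = decided-⊥
  Δ₀⇒stable (eq t u)  θ = decided-≐ (subₜ θ t) (subₜ θ u)
  Δ₀⇒stable (le t u)  θ = decided-≤̇ (subₜ θ t) (subₜ θ u)
  Δ₀⇒stable (imp p q) θ = decided-⇒ (Δ₀⇒stable p θ) (Δ₀⇒stable q θ)
  Δ₀⇒stable (and p q) θ = decided-∧ (Δ₀⇒stable p θ) (Δ₀⇒stable q θ)
  Δ₀⇒stable (or p q)  θ = decided-∨ (Δ₀⇒stable p θ) (Δ₀⇒stable q θ)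
  Δ₀⇒stable (all t {ψ} p) θ =
    -- The substituted bound is rewritten as a weakened term, so that it visibly avoids the
    -- quantified variable.
    subst (λ u → Decided (∀̇ (x₀ ≤̇ u ⇒ sub (lift θ) ψ))) (sym (lift-wkₜ θ t))
      (decided-∀≤ (stable-sub (lift θ) (Δ₀⇒stable p)) (subₜ θ t))
  Δ₀⇒stable (ex t {ψ} p) θ =
    subst (λ u → Decided (∃̇ (x₀ ≤̇ u ∧ sub (lift θ) ψ))) (sym (lift-wkₜ θ t))
      (decided-⇔ (∃≤-as-∀≤ _ _) (decided-¬
        (decided-∀≤ (stable-sub (lift θ) {¬̇ ψ} (λ τ → decided-¬ (Δ₀⇒stable p τ))) (subₜ θ t))))

  -- Completeness for Δ₀ and Σ₁ formulas

  P-true : S ⊢ P {n} (O ≐ O)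
  -- The empty substitution is vacuously simple, so its transparency carries the closed case to `n`
  -- variables.
  P-true = ⇒E (∧E₂ (simple⇒transparent []ₛ (λ ()) (O ≐ O))) (inst []ₛ P-true₀)
    where
    code : ∀ t → sub (t ∷ₛ []ₛ) Pr ≡ Pr ⟨ t ⟩
    code t = sub-cong (λ { zero → refl }) Pr
    P-true₀ : S ⊢ P {0} (O ≐ O)
    P-true₀ = cast (trans (code _) (sym (P-unfold (O ≐ O))))
      -- The provability predicate speaks about the numeral `⌜ O ≐ O ⌝`; the value of the closed
      -- term `⌜ O ≐ O ⌝ᵈ` computes to the same number.
      (⇒E (sub-≐ Pr []ₛ (≐-sym (S⊇PA _ (numeral-value ⌜ O ≐ O ⌝ᵈ (λ ())))))
        (cast (sym (code _)) (Equivalence.to (provability {0} (O ≐ O)) (≐I O))))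

  Δ₀-complete : {δ : Formula n} → Δ₀ δ → S ⊢ δ ⇒ P δ
  Δ₀-complete {δ = δ} p =
    -- `O ≐ O` serves as truth. Under `δ` the conditional selects the branch `P (O ≐ O)`, which
    -- `P-true` provides.
    ⇒E (⇒E (⇒E (taut ((a₀ ⟷ a₁) ⟶ (a₁ ⟷ iteₛ a₂ a₃ a₄) ⟶ a₃ ⟶ a₂ ⟶ a₀)
                  (P δ ∷ P (ITE δ (O ≐ O) ⊥̇) ∷ δ ∷ P (O ≐ O) ∷ P ⊥̇ ∷ []) refl)
             (P-⇔ (⇒E (taut (a₁ ⟶ (a₀ ⟷ iteₛ a₀ a₁ ff)) (δ ∷ O ≐ O ∷ []) refl) (≐I O))))
           (subst Decided (sub-var δ) (Δ₀⇒stable p var) (O ≐ O) ⊥̇))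
       P-true

  -- Stating the claim for the existential closure makes the recursion trivial: `∃* φ` and
  -- `∃* (∃̇ φ)` agree by definition, so the whole prefix is collected before a single use of `CB∃`
  -- at the Δ₀ matrix.
  Σ₁-complete : {φ : Formula n} → Σ₁ φ → S ⊢ ∃* φ ⇒ Pr ⟨ ⌜ ∃* φ ⌝ ⟩
  Σ₁-complete (matrix {φ} p) =
    ⇒I (⇒E (thm (cb∃ φ)) (⇒E (thm (∃*-mono (cast (cong (φ ⇒_) (P-unfold φ)) (Δ₀-complete p)))) (hyp (here refl))))
  Σ₁-complete (exists p) = Σ₁-complete p

theorem3p11 : (S T : Theory) →
    Consistent S → Consistent T →
    CETheory S → CETheory T →
    S Extends PA → T Extends PA →
    T Extends S →
    (Pr : Formula 1) → Σ₁ Pr →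
    IsProvabilityPredicate S T Pr →
    Eᵁ S T Pr →
    CB∃ S Pr →
    Σ₁C S Pr
theorem3p11 S T _ _ _ _ S⊇PA T⊇PA _ Pr _ provability eᵁ cb∃ φ p =
  Provability.Σ₁-complete S T S⊇PA T⊇PA Pr provability eᵁ cb∃ p
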